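{- Let $p$ be a prime, $N=p^e$ with $e\ge1$, and $\Lambda_N(U)=U(U-1)^{N-1}\in\mathbb F_p[U]$. Let $Q=p^m$ with $m\ge1$ and $Q\ge N$, and put $s=p^{\gcd(e,m)}$. Then $$\left(Q-\left\lceil\frac{Q-1}{N}\right\rceil\right)-\#\Lambda_N(\mathbb F_Q)=\frac Qs-\left\lceil\frac{Q-1}{N}\right\rceil.$$ This quantity is zero if and only if $\mathbb F_N\subseteq\mathbb F_Q$.
   Context: All finite fields of characteristic $p$ are regarded as subfields of a fixed algebraic closure $\overline{\mathbb F}_p$, so $\mathbb F_N\subseteq\mathbb F_Q$ means $e\mid m$. $\Lambda_N(\mathbb F_Q)$ denotes the image of $\Lambda_N$ on $\mathbb F_Q$. -}

module Defs where

open import Algebra.Apartness.Bundles using (HeytingField; HeytingCommutativeRing)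
open import Algebra.Bundles using (CommutativeRing)
open import Data.Fin.Base using (Fin; toℕ)
open import Data.Fin.Properties using (≡-setoid)
open import Data.List.Base using (List; map; allFin; length; deduplicate)
open import Data.Nat.Base using (ℕ; suc; _∸_)
open import Data.Product.Base using (Σ; ∃-syntax; proj₁; proj₂)
open import Function.Base using (_∘_)
open import Function.Bundles using (Bijection)
open import Level using (Level; _⊔_) renaming (suc to lsuc)
open import Relation.Binary.Bundles using (Setoid)
import Relation.Binary.Construct.On as On
open import Relation.Binary.Definitions using (Decidable; _Respects_)
open import Relation.Nullary.Decidable.Core using (yes; no)
open import Relation.Unary using (Pred; _∈_)

module FieldOperations {c ℓ₁ ℓ₂} (F : HeytingField c ℓ₁ ℓ₂) where
  open HeytingField F public

  commutativeRing : CommutativeRing c ℓ₁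
  commutativeRing = HeytingCommutativeRing.commutativeRing heytingCommutativeRing

  open CommutativeRing commutativeRing using (semiring)
  open import Algebra.Properties.Semiring.Exp semiring public using (_^_)
  open import Algebra.Properties.Semiring.Mult semiring public using (_×_)
  open import Algebra.Properties.Semiring.Sum semiring public using (sum)

  -- The monic polynomial Xⁿ + Σ_{i<n} aᵢ Xⁱ at x.
  evalMonic : ∀ {n} → (Fin n → Carrier) → Carrier → Carrier
  evalMonic {n} a x = x ^ n + sum (λ i → a i * x ^ toℕ i)

-- A Heyting field whose apartness is decidable is a field in the classical
-- sense: every element is zero or invertible.
record AlgebraicClosureOf𝔽 (p : ℕ) (c ℓ₁ ℓ₂ : Level) : Set (lsuc (c ⊔ ℓ₁ ⊔ ℓ₂)) where
  field
    heytingField : HeytingField c ℓ₁ ℓ₂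

  open FieldOperations heytingField public

  field
    _#?_           : Decidable _#_
    characteristic : p × 1# ≈ 0#
    closed         : ∀ n (a : Fin (suc n) → Carrier) → ∃[ x ] evalMonic a x ≈ 0#
    -- For p prime, the prime field consists of the natural multiples of 1#.
    algebraic      : ∀ x → ∃[ n ] Σ (Fin n → ℕ) λ a → evalMonic (λ i → a i × 1#) x ≈ 0#

  _≟_ : Decidable _≈_
  x ≟ y with x #? y
  ... | yes x#y = no λ x≈y → proj₂ (tight x y) x≈y x#y
  ... | no ¬x#y = yes (proj₁ (tight x y) ¬x#y)

module _ {p c ℓ₁ ℓ₂} (Ω : AlgebraicClosureOf𝔽 p c ℓ₁ ℓ₂) where
  open AlgebraicClosureOf𝔽 Ω

  subsetSetoid : ∀ {ℓ} → Pred Carrier ℓ → Setoid (c ⊔ ℓ) ℓ₁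
  subsetSetoid P = On.setoid {B = Σ Carrier P} setoid proj₁

  -- A subfield with exactly q elements.
  record Subfield (q : ℕ) (ℓ : Level) : Set (c ⊔ ℓ₁ ⊔ lsuc ℓ) where
    field
      member    : Pred Carrier ℓ
      resp      : member Respects _≈_
      0∈        : 0# ∈ member
      1∈        : 1# ∈ member
      +-closed  : ∀ {x y} → x ∈ member → y ∈ member → x + y ∈ member
      neg-closed : ∀ {x} → x ∈ member → - x ∈ member
      *-closed  : ∀ {x y} → x ∈ member → y ∈ member → x * y ∈ member
      inv-closed : ∀ {x y} → x ∈ member → x * y ≈ 1# → y ∈ member
      order     : Bijection (≡-setoid q) (subsetSetoid member)

    elements : List Carrier
    elements = map (proj₁ ∘ Bijection.to order) (allFin q)

  open Subfield public using (member)

  Λ : ℕ → Carrier → Carrier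
  Λ N u = u * (u - 1#) ^ (N ∸ 1)

  -- The number of distinct values of f on F.
  #image : ∀ {q ℓ} → (Carrier → Carrier) → Subfield q ℓ → ℕ
  #image f F = length (deduplicate _≟_ (map f (Subfield.elements F)))

{-# OPTIONS --safe #-}

-- For a ≠ 0 the substitution w = 1 / (u − 1) turns Λ u = a into a w^N − w = 1,
-- an affine equation for an additive map.  If that map is injective on F it is
-- onto, so a is a value of Λ.  Otherwise a = b^(N−1) for some b ≠ 0, and rescaling
-- by b shows that a is a value exactly when b = z^N − z is solvable in F.  Hence the
-- missing values are the b^(N−1) with b outside the image of L z = z^N − z.
-- The kernel of L is the fixed field of x ↦ x^s, which has s elements, so L has
-- Q / s values; the (N−1)-st power map has fibres of size s − 1 on the Q − Q / s
-- elements outside the image, and therefore Q / s values are missing.  Finally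
-- ⌈(Q − 1) / N⌉ = Q / N, and s = N exactly when F contains all N roots of X^N − X.

module Submission where

open import Defs
open import Algebra.Bundles using (CommutativeRing)
import Algebra.Properties.Semiring.Mult as Mult
open import Data.Fin.Base using (Fin; zero; suc)
open import Data.Fin.Permutation using (Permutation; permutation; _⟨$⟩ʳ_)
import Data.Fin.Properties as Fin
open import Data.Integer.Base as ℤ using (ℤ)
import Data.Integer.Properties as ℤ
import Data.Integer.Tactic.RingSolver as ℤ-Solver
open import Data.List.Base as List using (List; []; _∷_; length; deduplicate)
import Data.List.Properties as List
open import Data.List.Relation.Unary.All as All using (All; []; _∷_)
import Data.List.Relation.Unary.All.Properties as All
open import Data.List.Relation.Unary.AllPairs using ([]; _∷_)
open import Data.List.Relation.Unary.Any as Any using (Any; here; there)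
import Data.List.Relation.Unary.Any.Properties as Any
open import Data.List.Relation.Unary.Unique.DecSetoid.Properties using (deduplicate-!)
open import Data.List.Relation.Unary.Unique.Propositional.Properties using (allFin⁺)
open import Data.List.Relation.Unary.Unique.Setoid using (Unique)
import Data.List.Relation.Unary.Unique.Setoid.Properties as Unique
open import Data.Maybe.Base using (nothing)
open import Data.Nat.Base as ℕ using (ℕ; zero; suc; _≤_; _<_; z≤n; s≤s; _∸_; NonZero)
open import Data.Nat.Combinatorics using (_C_; nCn≡1; nCk≡n!/k![n-k]!; k![n∸k]!∣n!)
open import Data.Nat.Coprimality using (Coprime)
open import Data.Nat.Divisibility using (_∣_; divides; ∣⇒≤; m∣m*n; ∣1⇒≡1; ∣m+n∣m⇒∣n; ∣-trans)
open import Data.Nat.DivMod using (m/n*n≡m; [m+kn]%n≡m%n; m<n⇒m%n≡m; +-distrib-/-∣ʳ; m<n⇒m/n≡0; m*n/n≡m)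
open import Data.Nat.GCD using (gcd; gcd-GCD; gcd[m,n]∣m; gcd[m,n]∣n; gcd[m,n]≢0; module Bézout)
open import Data.Nat.Primality using (Prime; euclidsLemma; prime⇒nonTrivial)
import Data.Nat.Properties as ℕ
open import Data.Nat.Solver using (module +-*-Solver)
open import Data.Product.Base using (∃; _,_; proj₁; proj₂)
open import Data.Rational.Base as ℚ using (ceiling)
import Data.Rational.Properties as ℚ
open import Data.Sum.Base using (_⊎_; inj₁; inj₂; [_,_]′)
open import Data.Unit.Base using (tt)
open import Data.Vec.Base using (Vec; []; _∷_; replicate)
open import Data.Vec.Functional using (init; last; tail)
open import Function.Base using (_∘_; id)
open import Function.Bundles using (Bijection; _⇔_; mk⇔)
open import Level using (Level)
open import Relation.Binary.Bundles using (DecSetoid)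
open import Relation.Binary.Definitions using (_Respects_)
open import Relation.Binary.PropositionalEquality as ≡ using (_≡_)
open import Relation.Nullary using (Dec; yes; no; ¬_)
open import Relation.Nullary.Decidable using (map′; ¬?; _×-dec_)
open import Relation.Nullary.Negation using (contradiction)
open import Relation.Unary as U using (Pred; _∈_)
open import Relation.Unary.Properties using (U?)
open import Tactic.RingSolver using (solve-∀)
open import Tactic.RingSolver.Core.AlmostCommutativeRing using (AlmostCommutativeRing; fromCommutativeRing)
import Algebra.Properties.Semiring.Sum ℕ.+-*-semiring as ∑

-- Binomial coefficients modulo a prime, and the Frobenius map.

module PrimeBinomial {p} (p-prime : Prime p) where
  open import Data.Nat.Base using (_*_; _!)
  open import Data.Nat.Properties using (_!*_!≢0)

  private
    1<p : 1 < p
    1<p = ℕ.nonTrivial⇒n>1 p {{prime⇒nonTrivial p-prime}}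

  ∤factorial : ∀ {k} → k < p → ¬ p ∣ k !
  ∤factorial {zero}  k<p p∣k! = ℕ.<⇒≱ 1<p (∣⇒≤ p∣k!)
  ∤factorial {suc k} k<p p∣k! with euclidsLemma (suc k) (k !) p-prime p∣k!
  ... | inj₁ p∣k  = ℕ.<⇒≱ k<p (∣⇒≤ p∣k)
  ... | inj₂ p∣k! = ∤factorial (ℕ.<-trans (ℕ.n<1+n k) k<p) p∣k!

  -- The product of `p C k` with `k ! * (p ∸ k) !` is `p !`, which `p` divides; both factorials have
  -- only factors below `p`, so Euclid's lemma leaves the binomial coefficient.
  ∣binomial : ∀ {k} → 0 < k → k < p → p ∣ p C k
  ∣binomial {k} 0<k k<p with euclidsLemma (p C k) (k ! * (p ∸ k) !) p-prime p∣
    where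
    instance _ = k !* (p ∸ k) !≢0
    n∣n! : ∀ {n} → 1 < n → n ∣ n !
    n∣n! {suc n} _ = m∣m*n (n !)
    p∣ : p ∣ (p C k) * (k ! * (p ∸ k) !)
    p∣ = ≡.subst (p ∣_) (≡.sym (≡.trans
      (≡.cong (_* (k ! * (p ∸ k) !)) (nCk≡n!/k![n-k]! (ℕ.<⇒≤ k<p))) (m/n*n≡m (k![n∸k]!∣n! (ℕ.<⇒≤ k<p))))) (n∣n! 1<p)
  ... | inj₁ p∣C = p∣C
  ... | inj₂ p∣k!l! with euclidsLemma (k !) ((p ∸ k) !) p-prime p∣k!l!
  ...   | inj₁ p∣k! = contradiction p∣k! (∤factorial k<p)
  ...   | inj₂ p∣l! = contradiction p∣l! (∤factorial (ℕ.∸-monoʳ-< 0<k (ℕ.<⇒≤ k<p)))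

module Frobenius {c ℓ} (R : CommutativeRing c ℓ) {p} (p-prime : Prime p)
  (p×1≈0 : CommutativeRing._≈_ R (Mult._×_ (CommutativeRing.semiring R) p (CommutativeRing.1# R)) (CommutativeRing.0# R))
  where

  open CommutativeRing R hiding (zero)
  open Mult semiring using (_×_; ×-congʳ; ×-assocˡ; ×-assoc-*; ×-homo-1)
  open import Algebra.Properties.Semiring.Exp semiring
  open import Algebra.Properties.Semiring.Sum semiring using (sum; sum-cong-≋; sum-replicate-zero; sum-init-last)
  open import Algebra.Properties.CommutativeSemiring.Binomial commutativeSemiring using (binomialTerm; theorem)
  open import Relation.Binary.Reasoning.Setoid setoid

  p∣n⇒n×x≈0 : ∀ {n} → p ∣ n → ∀ x → n × x ≈ 0#
  p∣n⇒n×x≈0 (divides k ≡.refl) x = begin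
    (k ℕ.* p) × x            ≈⟨ ×-assocˡ x k p ⟨
    k × (p × x)              ≈⟨ ×-congʳ k (×-congʳ p (*-identityˡ x)) ⟨
    k × (p × (1# * x))       ≈⟨ ×-congʳ k (×-assoc-* p 1# x) ⟨
    k × ((p × 1#) * x)       ≈⟨ ×-congʳ k (*-congʳ p×1≈0) ⟩
    k × (0# * x)             ≈⟨ ×-congʳ k (zeroˡ x) ⟩
    k × 0#                   ≈⟨ k×0≈0 k ⟩
    0#                       ∎
    where
    k×0≈0 : ∀ k → k × 0# ≈ 0#
    k×0≈0 zero    = refl
    k×0≈0 (suc k) = trans (+-identityˡ _) (k×0≈0 k)

  -- In the binomial expansion every coefficient strictly between the two ends is a multiple of `p`,
  -- so only the end terms survive.
  ^p-homo-+ : ∀ x y → (x + y) ^ p ≈ x ^ p + y ^ p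
  ^p-homo-+ x y = go p ≡.refl
    where
    open PrimeBinomial p-prime
    -- Matching on `n` exhibits `p` as a successor, so that the first and last terms can be split
    -- off the binomial sum.
    go : ∀ n → n ≡ p → (x + y) ^ n ≈ x ^ n + y ^ n
    go zero    ≡.refl with () ← ℕ.nonTrivial⇒n>1 0 {{prime⇒nonTrivial p-prime}}
    go (suc n) ≡.refl = begin
      (x + y) ^ p                                   ≈⟨ theorem p x y ⟩
      t zero + sum (tail t)                         ≈⟨ +-congˡ (sum-init-last (tail t)) ⟩
      t zero + (sum (init (tail t)) + last t)       ≈⟨ +-cong first (+-cong middle final) ⟩
      y ^ p + (0# + x ^ p)                          ≈⟨ +-congˡ (+-identityˡ _) ⟩
      y ^ p + x ^ p                                 ≈⟨ +-comm _ _ ⟩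
      x ^ p + y ^ p                                 ∎
      where
      t = binomialTerm x y p
      first : t zero ≈ y ^ p
      first = trans (×-homo-1 _) (*-identityˡ _)
      middle : sum (init (tail t)) ≈ 0#
      middle = trans (sum-cong-≋ {n} λ i → p∣n⇒n×x≈0 (∣binomial (s≤s z≤n)
        (s≤s (≡.subst (_< n) (≡.sym (Fin.toℕ-inject₁ i)) (Fin.toℕ<n i)))) _) (sum-replicate-zero n)
      final : last t ≈ x ^ p
      final rewrite Fin.toℕ-fromℕ n | nCn≡1 p | ℕ.n∸n≡0 n = trans (×-homo-1 _) (*-identityʳ _)

  ^pᵏ-homo-+ : ∀ k x y → (x + y) ^ (p ℕ.^ k) ≈ x ^ (p ℕ.^ k) + y ^ (p ℕ.^ k)
  ^pᵏ-homo-+ zero    x y = trans (*-identityʳ _) (sym (+-cong (*-identityʳ x) (*-identityʳ y)))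
  ^pᵏ-homo-+ (suc k) x y = begin
    (x + y) ^ (p ℕ.* r)              ≈⟨ ^-assocʳ (x + y) p r ⟨
    ((x + y) ^ p) ^ r                ≈⟨ ^-congˡ r (^p-homo-+ x y) ⟩
    (x ^ p + y ^ p) ^ r              ≈⟨ ^pᵏ-homo-+ k _ _ ⟩
    (x ^ p) ^ r + (y ^ p) ^ r        ≈⟨ +-cong (^-assocʳ x p r) (^-assocʳ y p r) ⟩
    x ^ (p ℕ.* r) + y ^ (p ℕ.* r)    ∎
    where r = p ℕ.^ k

open import Data.Product.Base using (_×_)

-- Sums of indicator functions.

module Indicator where
  open import Data.Nat.Base using (_+_; _*_)

  private
    variable
      a b c : Level
      A : Set a
      B : Set b
      C : Set c

  χ : Dec A → ℕ
  χ (yes _) = 1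
  χ (no _)  = 0

  χ-mono : (A → B) → (A? : Dec A) (B? : Dec B) → χ A? ≤ χ B?
  χ-mono f (no _)  _        = z≤n
  χ-mono f (yes _) (yes _)  = ℕ.≤-refl
  χ-mono f (yes a) (no ¬b)  = contradiction (f a) ¬b

  χ-cong : (A → B) → (B → A) → (A? : Dec A) (B? : Dec B) → χ A? ≡ χ B?
  χ-cong f g A? B? = ℕ.≤-antisym (χ-mono f A? B?) (χ-mono g B? A?)

  χ-≤-cover : (A → B ⊎ C) → (A? : Dec A) (B? : Dec B) (C? : Dec C) → χ A? ≤ χ B? + χ C?
  χ-≤-cover f (no _)  _        _        = z≤n
  χ-≤-cover f (yes _) (yes _)  _        = s≤s z≤n
  χ-≤-cover f (yes _) (no _)   (yes _)  = ℕ.≤-refl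
  χ-≤-cover f (yes a) (no ¬b)  (no ¬c)  = contradiction (f a) [ ¬b , ¬c ]′

  χ-≥-disjoint : (B → A) → (C → A) → (B → ¬ C) → (A? : Dec A) (B? : Dec B) (C? : Dec C) → χ B? + χ C? ≤ χ A?
  χ-≥-disjoint f g d A? (yes b) (yes c) = contradiction c (d b)
  χ-≥-disjoint f g d A? (yes b) (no _)  = χ-mono f (yes b) A?
  χ-≥-disjoint f g d A? (no _)  C?      = χ-mono g C? A?

  χ-× : (A? : Dec A) (B? : Dec B) → χ (A? ×-dec B?) ≡ χ A? * χ B?
  χ-× (yes _) (yes _) = ≡.refl
  χ-× (yes _) (no _)  = ≡.refl
  χ-× (no _)  (yes _) = ≡.refl
  χ-× (no _)  (no _)  = ≡.refl

  χ-¬ : (A? : Dec A) → χ A? + χ (¬? A?) ≡ 1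
  χ-¬ (yes _) = ≡.refl
  χ-¬ (no _)  = ≡.refl

  χ-yes : (A? : Dec A) → A → χ A? ≡ 1
  χ-yes (yes _) a = ≡.refl
  χ-yes (no ¬a) a = contradiction a ¬a

  χ-no : (A? : Dec A) → ¬ A → χ A? ≡ 0
  χ-no (yes a) ¬a = contradiction a ¬a
  χ-no (no _)  ¬a = ≡.refl

  sum-mono : ∀ {n} {f g : Fin n → ℕ} → (∀ i → f i ≤ g i) → ∑.sum f ≤ ∑.sum g
  sum-mono {zero}  f≤g = z≤n
  sum-mono {suc n} f≤g = ℕ.+-mono-≤ (f≤g zero) (sum-mono (f≤g ∘ suc))

  sum-const : ∀ n c → ∑.sum {n} (λ _ → c) ≡ n * c
  sum-const zero    c = ≡.refl
  sum-const (suc n) c = ≡.cong (c +_) (sum-const n c)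

  sum-δ : ∀ {n} (j : Fin n) → ∑.sum (λ i → χ (i Fin.≟ j)) ≡ 1
  sum-δ {suc n} zero = ≡.cong suc (≡.trans (sum-const n 0) (ℕ.*-zeroʳ n))
  sum-δ (suc j) = ≡.trans
    (∑.sum-cong-≗ (λ i → χ-cong Fin.suc-injective (≡.cong suc) (suc i Fin.≟ suc j) (i Fin.≟ j))) (sum-δ j)

open Indicator

-- Counting elements of a finite subfield: permutations, fibres, images.

module Counting {p c ℓ₁ ℓ₂} {Ω : AlgebraicClosureOf𝔽 p c ℓ₁ ℓ₂} {q ℓ} (F : Subfield Ω q ℓ) where
  open AlgebraicClosureOf𝔽 Ω using (Carrier; _≈_; sym; trans; _≟_; setoid; isEquivalence)
  open import Data.Nat.Base using (_+_; _*_)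
  open Subfield F using (resp; order)
  open Subfield using (elements)
  private module order = Bijection order

  el : Fin q → Carrier
  el = proj₁ ∘ order.to

  el∈ : ∀ i → el i ∈ member F
  el∈ = proj₂ ∘ order.to

  el-injective : ∀ {i j} → el i ≈ el j → i ≡ j
  el-injective = order.injective

  index : ∀ {x} → x ∈ member F → Fin q
  index x∈ = proj₁ (order.surjective (_ , x∈))

  el-index : ∀ {x} (x∈ : x ∈ member F) → el (index x∈) ≈ x
  el-index x∈ = proj₂ (order.surjective (_ , x∈)) ≡.refl

  length-elements : length (elements F) ≡ q
  length-elements = ≡.trans (List.length-map el (List.allFin q)) (List.length-tabulate {n = q} id)

  member? : U.Decidable (member F)
  member? x = map′ (λ (i , elᵢ≈x) → resp elᵢ≈x (el∈ i)) (λ x∈ → index x∈ , el-index x∈) (Fin.any? λ i → el i ≟ x)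

  -- Cardinality as a sum over positions: double counting becomes an exchange of sums, and
  -- invariance under bijections becomes reindexing.
  # : ∀ {a} {P : Pred Carrier a} → U.Decidable P → ℕ
  # P? = ∑.sum λ i → χ (P? (el i))

  module _ {a b} {P : Pred Carrier a} {R : Pred Carrier b} (P? : U.Decidable P) (R? : U.Decidable R) where

    #-mono : (∀ i → P (el i) → R (el i)) → # P? ≤ # R?
    #-mono P⊆R = sum-mono λ i → χ-mono (P⊆R i) (P? (el i)) (R? (el i))

    #-cong : (∀ i → P (el i) → R (el i)) → (∀ i → R (el i) → P (el i)) → # P? ≡ # R?
    #-cong P⊆R R⊆P = ∑.sum-cong-≗ λ i → χ-cong (P⊆R i) (R⊆P i) (P? (el i)) (R? (el i))

  module _ {a b c} {P : Pred Carrier a} {R : Pred Carrier b} {S : Pred Carrier c}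
    (P? : U.Decidable P) (R? : U.Decidable R) (S? : U.Decidable S) where

    #-≤-cover : (∀ i → P (el i) → R (el i) ⊎ S (el i)) → # P? ≤ # R? + # S?
    #-≤-cover split = ≡.subst (# P? ≤_) (∑.∑-distrib-+ {q} _ _)
      (sum-mono λ i → χ-≤-cover (split i) (P? (el i)) (R? (el i)) (S? (el i)))

    #-≥-disjoint : (∀ i → R (el i) → P (el i)) → (∀ i → S (el i) → P (el i)) → (∀ i → R (el i) → ¬ S (el i)) →
                   # R? + # S? ≤ # P?
    #-≥-disjoint R⊆P S⊆P disjoint = ≡.subst (_≤ # P?) (∑.∑-distrib-+ {q} _ _)
      (sum-mono λ i → χ-≥-disjoint (R⊆P i) (S⊆P i) (disjoint i) (P? (el i)) (R? (el i)) (S? (el i)))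

  module _ {a} {P : Pred Carrier a} (P? : U.Decidable P) where

    #-all : (∀ i → P (el i)) → # P? ≡ q
    #-all all = ≡.trans (∑.sum-cong-≗ λ i → χ-yes (P? (el i)) (all i)) (≡.trans (sum-const q 1) (ℕ.*-identityʳ q))

    #-none : (∀ i → ¬ P (el i)) → # P? ≡ 0
    #-none none = ≡.trans (∑.sum-cong-≗ λ i → χ-no (P? (el i)) (none i)) (≡.trans (sum-const q 0) (ℕ.*-zeroʳ q))

    #-complement : # P? + # (λ x → ¬? (P? x)) ≡ q
    #-complement = ≡.trans (≡.sym (∑.∑-distrib-+ {q} _ _))
      (≡.trans (∑.sum-cong-≗ λ i → χ-¬ (P? (el i))) (≡.trans (sum-const q 1) (ℕ.*-identityʳ q)))

  #-singleton : ∀ {a} → a ∈ member F → # (_≟ a) ≡ 1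
  #-singleton a∈ = ≡.trans
    (∑.sum-cong-≗ λ i → χ-cong (λ elᵢ≈a → el-injective (trans elᵢ≈a (sym (el-index a∈))))
      (λ { ≡.refl → el-index a∈ }) (el i ≟ _) (i Fin.≟ index a∈))
    (sum-δ (index a∈))

  -- The complement has count 0, whereas a position where `P` fails would contribute at least 1 to
  -- it.
  #-full : ∀ {a} {P : Pred Carrier a} (P? : U.Decidable P) → # P? ≡ q → ∀ i → P (el i)
  #-full P? #P≡q i with P? (el i)
  ... | yes Pi = Pi
  ... | no ¬Pi = contradiction some-fail (ℕ.<-irrefl (≡.sym none-fail))
    where
    none-fail : # (λ x → ¬? (P? x)) ≡ 0
    none-fail = ℕ.+-cancelˡ-≡ q _ _ (≡.trans
      (≡.cong (_+ # (λ x → ¬? (P? x))) (≡.sym #P≡q)) (≡.trans (#-complement P?) (≡.sym (ℕ.+-identityʳ q))))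
    some-fail : 0 < # (λ x → ¬? (P? x))
    some-fail = ≡.subst (_≤ # (λ x → ¬? (P? x))) (sum-δ i)
      (sum-mono λ j → χ-mono (λ { ≡.refl → ¬Pi }) (j Fin.≟ i) (¬? (P? (el j))))

  module _ {g h : Carrier → Carrier}
    (g-cong : ∀ {x y} → x ≈ y → g x ≈ g y) (h-cong : ∀ {x y} → x ≈ y → h x ≈ h y)
    (g∈ : ∀ {x} → x ∈ member F → g x ∈ member F) (h∈ : ∀ {x} → x ∈ member F → h x ∈ member F)
    (gh : ∀ x → g (h x) ≈ x) (hg : ∀ x → h (g x) ≈ x)
    where

    -- Transport to positions is what reindexing needs, both for sums of indicators and for the
    -- product in `lagrange`.
    bijection⇒permutation : Permutation q q
    bijection⇒permutation = permutation (λ i → index (g∈ (el∈ i))) (λ i → index (h∈ (el∈ i)))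
      (λ i → el-injective (trans (el-index _) (trans (g-cong (el-index _)) (gh (el i)))))
      (λ i → el-injective (trans (el-index _) (trans (h-cong (el-index _)) (hg (el i)))))

    #-permute : ∀ {a} {P : Pred Carrier a} (P? : U.Decidable P) → P Respects _≈_ → # P? ≡ # (P? ∘ g)
    #-permute P? P-resp = ≡.trans (∑.sum-permute _ bijection⇒permutation)
      (∑.sum-cong-≗ λ i → χ-cong (P-resp (el-index _)) (P-resp (sym (el-index _))) (P? _) (P? (g (el i))))

  module _ {a} {P : Pred Carrier a} (P? : U.Decidable P) (g : Carrier → Carrier) where

    -- Quantifying over positions instead of members makes this a finite search, hence decidable.
    Image : Pred Carrier _
    Image y = ∃ λ i → P (el i) × g (el i) ≈ y

    Image? : U.Decidable Image
    Image? y = Fin.any? λ i → P? (el i) ×-dec (g (el i) ≟ y)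

    Fibre? : ∀ y → U.Decidable (λ x → P x × g x ≈ y)
    Fibre? y x = P? x ×-dec (g x ≟ y)

    module _ (g∈ : ∀ {x} → x ∈ member F → g x ∈ member F) where

      -- Double counting: each `g (el i)` equals exactly one `el j`, so the inner sum over `j`
      -- inserted here is 1, and the two sums may be exchanged.
      #-fibres : # P? ≡ ∑.sum λ j → # (Fibre? (el j))
      #-fibres = begin
        # P?
          ≡⟨ ∑.sum-cong-≗ (λ i → ≡.trans (≡.sym (ℕ.*-identityʳ _)) (≡.cong (χ (P? (el i)) *_) (≡.sym (unique i)))) ⟩
        ∑.sum (λ i → χ (P? (el i)) * ∑.sum (λ j → χ (g (el i) ≟ el j)))
          ≡⟨ ∑.sum-cong-≗ (λ i → ∑.*-distribˡ-sum {q} (χ (P? (el i))) _) ⟩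
        ∑.sum (λ i → ∑.sum (λ j → χ (P? (el i)) * χ (g (el i) ≟ el j)))
          ≡⟨ ∑.∑-comm {q} {q} _ ⟩
        ∑.sum (λ j → ∑.sum (λ i → χ (P? (el i)) * χ (g (el i) ≟ el j)))
          ≡⟨ ∑.sum-cong-≗ (λ j → ∑.sum-cong-≗ (λ i → ≡.sym (χ-× (P? (el i)) (g (el i) ≟ el j)))) ⟩
        ∑.sum (λ j → # (Fibre? (el j)))
          ∎
        where
        open ≡.≡-Reasoning
        unique : ∀ i → ∑.sum (λ j → χ (g (el i) ≟ el j)) ≡ 1
        unique i = ≡.trans (∑.sum-cong-≗ λ j → χ-cong sym sym (g (el i) ≟ el j) (el j ≟ g (el i))) (#-singleton (g∈ (el∈ i)))

      module _ (t : ℕ) where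

        private
          -- The form `t * 0` matches `t * χ (Image? (el j))` off the image.
          empty : ∀ j → ¬ Image (el j) → # (Fibre? (el j)) ≡ t * 0
          empty j ¬im = ≡.trans (#-none (Fibre? (el j)) λ i fibre → ¬im (i , fibre)) (≡.sym (ℕ.*-zeroʳ t))

          nonempty : ∀ i j → g (el i) ≈ el j → # (Fibre? (g (el i))) ≡ # (Fibre? (el j))
          nonempty i j eq = #-cong (Fibre? _) (Fibre? _)
            (λ _ (Px , gx≈) → Px , trans gx≈ eq) (λ _ (Px , gx≈) → Px , trans gx≈ (sym eq))

        #-image-≤ : (∀ i → P (el i) → # (Fibre? (g (el i))) ≤ t) → # P? ≤ t * # Image?
        #-image-≤ bound = ≡.subst₂ _≤_ (≡.sym #-fibres) (≡.sym (∑.*-distribˡ-sum {q} t _)) (sum-mono fibre)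
          where
          fibre : ∀ j → # (Fibre? (el j)) ≤ t * χ (Image? (el j))
          fibre j with Image? (el j)
          ... | yes (i , Pi , eq) = ≡.subst₂ _≤_ (nonempty i j eq) (≡.sym (ℕ.*-identityʳ t)) (bound i Pi)
          ... | no ¬im = ℕ.≤-reflexive (empty j ¬im)

        #-image-≡ : (∀ i → P (el i) → # (Fibre? (g (el i))) ≡ t) → # P? ≡ t * # Image?
        #-image-≡ exact = ≡.trans #-fibres (≡.trans (∑.sum-cong-≗ fibre) (≡.sym (∑.*-distribˡ-sum {q} t _)))
          where
          fibre : ∀ j → # (Fibre? (el j)) ≡ t * χ (Image? (el j))
          fibre j with Image? (el j)
          ... | yes (i , Pi , eq) = ≡.trans (≡.sym (nonempty i j eq)) (≡.trans (exact i Pi) (≡.sym (ℕ.*-identityʳ t)))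
          ... | no ¬im = empty j ¬im

  private
    decSetoid : DecSetoid c ℓ₁
    decSetoid = record { isDecEquivalence = record { isEquivalence = isEquivalence ; _≟_ = _≟_ } }

  Listed? : ∀ xs → U.Decidable (λ x → Any (x ≈_) xs)
  Listed? xs x = Any.any? (x ≟_) xs

  -- By distinctness the head is not repeated in the tail, so each step counts one singleton and a
  -- set disjoint from it.
  #-listed : ∀ {xs} → Unique setoid xs → All (member F) xs → # (Listed? xs) ≡ length xs
  #-listed []                    []          = #-none (Listed? []) λ _ ()
  #-listed {x ∷ xs} (x∉xs ∷ xs!) (x∈ ∷ xs∈) = ≡.trans (ℕ.≤-antisym
    (#-≤-cover (Listed? (x ∷ xs)) (_≟ x) (Listed? xs) λ { _ (here ≈x) → inj₁ ≈x ; _ (there ∈xs) → inj₂ ∈xs })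
    (#-≥-disjoint (Listed? (x ∷ xs)) (_≟ x) (Listed? xs) (λ _ → here) (λ _ → there)
      (λ _ ≈x ∈xs → All.All¬⇒¬Any x∉xs (Any.map (trans (sym ≈x)) ∈xs))))
    (≡.cong₂ _+_ (#-singleton x∈) (#-listed xs! xs∈))

  -- Bridge from the deduplicated list of values to the indicator count: that list has no
  -- repetitions and contains exactly the values of `f`.
  #image-≡-#Image : ∀ {f} → (∀ {x} → x ∈ member F → f x ∈ member F) → #image Ω f F ≡ # (Image? U? f)
  #image-≡-#Image {f} f∈ = ≡.trans
    (≡.sym (#-listed (deduplicate-! decSetoid values)
      (All.deduplicate⁺ _≟_ (All.map⁺ (All.map⁺ (All.tabulate⁺ λ i → f∈ (el∈ i)))))))
    (#-cong (Listed? (deduplicate _≟_ values)) (Image? U? f)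
      (λ _ listed → let (i , ≈fi) = Any.satisfied (Any.map⁻ (Any.map⁻ (Any.deduplicate⁻ _≟_ listed))) in i , _ , sym ≈fi)
      (λ _ (i , _ , eq) → Any.deduplicate⁺ _≟_ (λ z≈y x≈y → trans x≈y (sym z≈y))
        (Any.map⁺ (Any.map⁺ (Any.tabulate⁺ i (sym eq))))))
    where
    values : List Carrier
    values = List.map f (elements F)

-- Ring identities, monic polynomials and their roots.

module RingIdentities {c ℓ} (R : CommutativeRing c ℓ) where

  private
    ring : AlmostCommutativeRing c ℓ
    ring = fromCommutativeRing R λ _ → nothing

  open AlmostCommutativeRing ring

  taylor-step : ∀ a r d b q → a + (r + d) * (b + d * q) ≈ a + r * b + d * (b + (r + d) * q)
  taylor-step = solve-∀ ring

  exchange : ∀ z Z u V → (z * Z) * (u * V) ≈ (u * z) * (V * Z)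
  exchange = solve-∀ ring

  sum-difference : ∀ c x y x′ y′ → c * (x + y) + (x′ + y′) ≈ (c * x + x′) + (c * y + y′)
  sum-difference = solve-∀ ring

module MonicPolynomial {c ℓ} (R : CommutativeRing c ℓ) where
  open CommutativeRing R hiding (zero)
  open import Algebra.Properties.Semiring.Exp semiring using (_^_)
  open import Relation.Binary.Reasoning.Setoid setoid

  open RingIdentities R using (taylor-step)

  -- The leading coefficient 1 is implicit; the others are listed from the constant term upwards.
  eval : ∀ {n} → Vec Carrier n → Carrier → Carrier
  eval []       x = 1#
  eval (a ∷ as) x = a + x * eval as x

  eval-cong : ∀ {n} (as : Vec Carrier n) {x y} → x ≈ y → eval as x ≈ eval as y
  eval-cong []       x≈y = refl
  eval-cong (a ∷ as) x≈y = +-congˡ (*-cong x≈y (eval-cong as x≈y))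

  eval-powers : ∀ n x → eval (replicate n 0#) x ≈ x ^ n
  eval-powers zero    x = refl
  eval-powers (suc n) x = trans (+-identityˡ _) (*-congˡ (eval-powers n x))

  -- Division by `X - r` in Horner's scheme. The quotient is again monic, of one degree less, and
  -- its coefficients are the values at `r` of the successive tails. Writing the argument as `r + d`
  -- avoids subtraction.
  taylor : ∀ {n} a (as : Vec Carrier n) r → ∃ λ (qs : Vec Carrier n) →
           ∀ d → eval (a ∷ as) (r + d) ≈ eval (a ∷ as) r + d * eval qs (r + d)
  taylor a []       r = [] , λ d → trans (+-congˡ (distribʳ 1# r d)) (sym (+-assoc a (r * 1#) (d * 1#)))
  taylor a (b ∷ bs) r with qs , ih ← taylor b bs r =
    eval (b ∷ bs) r ∷ qs ,
    λ d → trans (+-congˡ (*-congˡ (ih d))) (taylor-step a r d (eval (b ∷ bs) r) (eval qs (r + d)))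

module Field {p c ℓ₁ ℓ₂} (Ω : AlgebraicClosureOf𝔽 p c ℓ₁ ℓ₂) where
  open AlgebraicClosureOf𝔽 Ω hiding (_×_; sum; zero) renaming (_≟_ to infix 4 _≟_)
  open CommutativeRing commutativeRing using (+-abelianGroup)
  open import Algebra.Apartness.Properties.HeytingCommutativeRing heytingCommutativeRing using (x-0≈x; 1#0)
  open import Algebra.Properties.AbelianGroup +-abelianGroup using (x∙y⁻¹≈ε⇒x≈y; xyx⁻¹≈y)
  open import Relation.Binary.Reasoning.Setoid setoid
  open MonicPolynomial commutativeRing public

  1≉0 : ¬ 1# ≈ 0#
  1≉0 1≈0 = proj₂ (tight _ _) 1≈0 1#0

  -- Decidable apartness and tightness turn `x ≉ 0` into `x # 0`, which yields an inverse of
  -- `x - 0#`.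
  inverse : ∀ {x} → ¬ x ≈ 0# → ∃ λ y → x * y ≈ 1#
  inverse {x} x≉0 with x #? 0#
  ... | no ¬x#0 = contradiction (proj₁ (tight _ _) ¬x#0) x≉0
  ... | yes x#0 with y , _ , [x-0]y≈1 ← #⇒invertible x#0 = y , trans (*-congʳ (sym (x-0≈x x))) [x-0]y≈1

  *-cancelˡ : ∀ {x} → ¬ x ≈ 0# → ∀ {y z} → x * y ≈ x * z → y ≈ z
  *-cancelˡ {x} x≉0 {y} {z} xy≈xz with w , xw≈1 ← inverse x≉0 = begin
    y            ≈⟨ *-identityˡ y ⟨
    1# * y       ≈⟨ *-congʳ (trans (*-comm w x) xw≈1) ⟨
    w * x * y    ≈⟨ *-assoc w x y ⟩
    w * (x * y)  ≈⟨ *-congˡ xy≈xz ⟩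
    w * (x * z)  ≈⟨ *-assoc w x z ⟨
    w * x * z    ≈⟨ *-congʳ (trans (*-comm w x) xw≈1) ⟩
    1# * z       ≈⟨ *-identityˡ z ⟩
    z            ∎

  *-integral : ∀ {x y} → x * y ≈ 0# → x ≈ 0# ⊎ y ≈ 0#
  *-integral {x} xy≈0 with x ≟ 0#
  ... | yes x≈0 = inj₁ x≈0
  ... | no x≉0  = inj₂ (*-cancelˡ x≉0 (trans xy≈0 (sym (zeroʳ x))))

  *-nonzero : ∀ {x y} → ¬ x ≈ 0# → ¬ y ≈ 0# → ¬ x * y ≈ 0#
  *-nonzero x≉0 y≉0 xy≈0 with *-integral xy≈0
  ... | inj₁ x≈0 = x≉0 x≈0
  ... | inj₂ y≈0 = y≉0 y≈0

  unit≉0 : ∀ {x y} → x * y ≈ 1# → ¬ x ≈ 0#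
  unit≉0 {_} {y} xy≈1 x≈0 = 1≉0 (trans (sym xy≈1) (trans (*-congʳ x≈0) (zeroˡ y)))

  ^-zero : ∀ n {x} → x ≈ 0# → x ^ suc n ≈ 0#
  ^-zero n {x} x≈0 = trans (*-congʳ x≈0) (zeroˡ _)

  ^-nonzero : ∀ n {x} → ¬ x ≈ 0# → ¬ x ^ n ≈ 0#
  ^-nonzero zero    x≉0 = 1≉0
  ^-nonzero (suc n) x≉0 = *-nonzero x≉0 (^-nonzero n x≉0)

  1^n≈1 : ∀ n → 1# ^ n ≈ 1#
  1^n≈1 zero    = refl
  1^n≈1 (suc n) = trans (*-identityˡ _) (1^n≈1 n)

  rootOfUnity≉0 : ∀ n {x} → x ^ suc n ≈ 1# → ¬ x ≈ 0#
  rootOfUnity≉0 n xⁿ≈1 x≈0 = 1≉0 (trans (sym xⁿ≈1) (^-zero n x≈0))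

  -- Division by `X - r` leaves remainder 0, and the field has no zero divisors. The root `r` may
  -- lie anywhere in `Ω`, which is used later for roots outside a subfield.
  factor : ∀ {n} a (as : Vec Carrier n) r → eval (a ∷ as) r ≈ 0# → ∃ λ (qs : Vec Carrier n) →
           ∀ x → eval (a ∷ as) x ≈ 0# → x ≈ r ⊎ eval qs x ≈ 0#
  factor a as r root with qs , eq ← taylor a as r = qs , split
    where
    split : ∀ x → eval (a ∷ as) x ≈ 0# → x ≈ r ⊎ eval qs x ≈ 0#
    split x x-root with *-integral product≈0
      where
      r+[x-r]≈x : r + (x - r) ≈ x
      r+[x-r]≈x = trans (sym (+-assoc r x (- r))) (xyx⁻¹≈y r x)
      product≈0 : (x - r) * eval qs x ≈ 0#
      product≈0 = begin
        (x - r) * eval qs x                                        ≈⟨ +-identityˡ _ ⟨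
        0# + (x - r) * eval qs x                                   ≈⟨ +-cong root (*-congˡ (eval-cong qs r+[x-r]≈x)) ⟨
        eval (a ∷ as) r + (x - r) * eval qs (r + (x - r))          ≈⟨ eq (x - r) ⟨
        eval (a ∷ as) (r + (x - r))                                ≈⟨ eval-cong (a ∷ as) r+[x-r]≈x ⟩
        eval (a ∷ as) x                                            ≈⟨ x-root ⟩
        0#                                                         ∎
    ... | inj₁ x-r≈0 = inj₁ (x∙y⁻¹≈ε⇒x≈y x r x-r≈0)
    ... | inj₂ q≈0   = inj₂ q≈0

-- Arithmetic of a finite field: root bounds, Fermat, kernels, fixed points of power maps.

module FiniteField {p c ℓ₁ ℓ₂} {Ω : AlgebraicClosureOf𝔽 p c ℓ₁ ℓ₂} {q ℓ} (F : Subfield Ω q ℓ) where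
  open AlgebraicClosureOf𝔽 Ω hiding (_×_; sum; zero) renaming (_≟_ to infix 4 _≟_)
  open CommutativeRing commutativeRing using (semiring; *-commutativeMonoid; +-abelianGroup)
  open import Algebra.Properties.Semiring.Exp semiring using (^-congˡ; ^-congʳ; ^-homo-*; ^-assocʳ)
  open import Algebra.Properties.AbelianGroup +-abelianGroup
    using (identityˡ-unique; //-rightDividesˡ; //-rightDividesʳ)
  open import Relation.Binary.Reasoning.Setoid setoid
  open Field Ω public
  open Counting F public
  open Subfield F hiding (member; order; elements)
  import Algebra.Properties.CommutativeMonoid.Sum *-commutativeMonoid as ∏

  Root? : ∀ {n} (as : Vec Carrier n) → U.Decidable (λ x → eval as x ≈ 0#)
  Root? as x = eval as x ≟ 0#

  -- Induction on the degree: a root found in `F` is split off, and the other roots are roots of the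
  -- quotient.
  #-roots : ∀ {n} (as : Vec Carrier n) → # (Root? as) ≤ n
  #-roots []       = ℕ.≤-reflexive (#-none (Root? []) λ _ → 1≉0)
  #-roots {suc n} (a ∷ as) with Fin.any? (λ i → Root? (a ∷ as) (el i))
  ... | no none = ℕ.≤-trans (ℕ.≤-reflexive (#-none (Root? (a ∷ as)) λ i root → none (i , root))) z≤n
  ... | yes (i , root) with qs , split ← factor a as (el i) root =
    ℕ.≤-trans (#-≤-cover (Root? (a ∷ as)) (_≟ el i) (Root? qs) (λ j → split (el j)))
              (ℕ.+-mono-≤ (ℕ.≤-reflexive (#-singleton (el∈ i))) (#-roots qs))

  -- A root outside `F` uses up one linear factor, which lowers the bound inside `F` by one.
  #-roots-∉ : ∀ {n} a (as : Vec Carrier n) {r} → ¬ r ∈ member F → eval (a ∷ as) r ≈ 0# → # (Root? (a ∷ as)) ≤ n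
  #-roots-∉ a as {r} r∉ root with qs , split ← factor a as r root =
    ℕ.≤-trans (#-≤-cover (Root? (a ∷ as)) (_≟ r) (Root? qs) (λ j → split (el j)))
              (ℕ.+-mono-≤ (ℕ.≤-reflexive (#-none (_≟ r) λ i ≈r → r∉ (Subfield.resp F ≈r (el∈ i)))) (#-roots qs))

  private
    X^_-_ : ∀ n (y : Carrier) → Vec Carrier (suc n)
    X^ n - y = - y ∷ replicate n 0#

    power⇒root : ∀ n {y} x → x ^ suc n ≈ y → eval (X^ n - y) x ≈ 0#
    power⇒root n {y} x power = trans (+-congˡ (trans (*-congˡ (eval-powers n x)) power)) (-‿inverseˡ y)

  #-power : ∀ n y → # (λ x → x ^ suc n ≟ y) ≤ suc n
  #-power n y = ℕ.≤-trans (#-mono (λ x → x ^ suc n ≟ y) (Root? (X^ n - y)) (λ i → power⇒root n (el i))) (#-roots (X^ n - y))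

  #-power-∉ : ∀ n {y r} → ¬ r ∈ member F → r ^ suc n ≈ y → # (λ x → x ^ suc n ≟ y) ≤ n
  #-power-∉ n {y} {r} r∉ power = ℕ.≤-trans (#-mono (λ x → x ^ suc n ≟ y) (Root? (X^ n - y)) (λ i → power⇒root n (el i)))
    (#-roots-∉ (- y) (replicate n 0#) r∉ (power⇒root n r power))

  ^-closed : ∀ n {x} → x ∈ member F → x ^ n ∈ member F
  ^-closed zero    x∈ = 1∈
  ^-closed (suc n) x∈ = *-closed x∈ (^-closed n x∈)

  1<q : 1 < q
  1<q = go q 0≢1
    where
    0≢1 : ¬ index 0∈ ≡ index 1∈
    0≢1 eq = 1≉0 (trans (sym (el-index 1∈)) (trans (reflexive (≡.cong el (≡.sym eq))) (el-index 0∈)))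
    go : ∀ q {i j : Fin q} → ¬ i ≡ j → 1 < q
    go 0             {i = ()}
    go 1             {i = zero} {j = zero} i≢j = contradiction ≡.refl i≢j
    go (suc (suc _)) _ = s≤s (s≤s z≤n)

  #-zero : # (_≟ 0#) ≡ 1
  #-zero = #-singleton 0∈

  #-nonzero : suc (# (λ x → ¬? (x ≟ 0#))) ≡ q
  #-nonzero = ≡.trans (≡.cong (ℕ._+ # (λ x → ¬? (x ≟ 0#))) (≡.sym #-zero)) (#-complement (_≟ 0#))

  module _ {a} (a≉0 : ¬ a ≈ 0#) (a∈ : a ∈ member F) where

    private
      b = proj₁ (inverse a≉0)
      ab≈1 : a * b ≈ 1#
      ab≈1 = proj₂ (inverse a≉0)

      cancel : ∀ {a b} → a * b ≈ 1# → ∀ x → a * (b * x) ≈ x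
      cancel {a} {b} ab≈1 x = trans (sym (*-assoc a b x)) (trans (*-congʳ ab≈1) (*-identityˡ x))

    scaling : Permutation q q
    scaling = bijection⇒permutation {a *_} {b *_} *-congˡ *-congˡ (*-closed a∈) (*-closed (inv-closed a∈ ab≈1))
      (cancel ab≈1) (cancel (trans (*-comm b a) ab≈1))

    #-scale : ∀ {ℓ′} {P : Pred Carrier ℓ′} (P? : U.Decidable P) → P Respects _≈_ → # P? ≡ # (P? ∘ (a *_))
    #-scale = #-permute {a *_} {b *_} *-congˡ *-congˡ (*-closed a∈) (*-closed (inv-closed a∈ ab≈1))
      (cancel ab≈1) (cancel (trans (*-comm b a) ab≈1))

    private
      -- Replacing 0 by 1 makes the product over all of `F` the product of its nonzero elements.
      unit : Carrier → Carrier
      unit x with x ≟ 0#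
      ... | yes _ = 1#
      ... | no _  = x

      unit-≉0 : ∀ x → ¬ unit x ≈ 0#
      unit-≉0 x with x ≟ 0#
      ... | yes _   = 1≉0
      ... | no x≉0  = x≉0

      -- The exponent is 0 at `x = 0` and 1 elsewhere, so the factors `a` accumulated over `F`
      -- number exactly the nonzero elements.
      unit-scale : ∀ {y} x → y ≈ a * x → unit y ≈ a ^ χ (¬? (x ≟ 0#)) * unit x
      unit-scale {y} x y≈ax with x ≟ 0# | y ≟ 0#
      ... | yes _   | yes _   = sym (*-identityʳ _)
      ... | yes x≈0 | no y≉0  = contradiction (trans y≈ax (trans (*-congˡ x≈0) (zeroʳ a))) y≉0
      ... | no x≉0  | yes y≈0 = contradiction (trans (sym y≈ax) y≈0) (*-nonzero a≉0 x≉0)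
      ... | no _    | no _    = trans y≈ax (*-congʳ (sym (*-identityʳ a)))

      ∏-power : ∀ {n} (f : Fin n → ℕ) → ∏.sum (λ i → a ^ f i) ≈ a ^ ∑.sum f
      ∏-power {zero}  f = refl
      ∏-power {suc n} f = trans (*-congˡ (∏-power (f ∘ suc))) (sym (^-homo-* a (f zero) _))

      ∏-nonzero : ∀ {n} (f : Fin n → Carrier) → (∀ i → ¬ f i ≈ 0#) → ¬ ∏.sum f ≈ 0#
      ∏-nonzero {zero}  f f≉0 = 1≉0
      ∏-nonzero {suc n} f f≉0 = *-nonzero (f≉0 zero) (∏-nonzero (f ∘ suc) (f≉0 ∘ suc))

    -- Multiplication by a permutes the nonzero elements, hence preserves their product.
    lagrange : a ^ # (λ x → ¬? (x ≟ 0#)) ≈ 1#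
    lagrange = *-cancelˡ (∏-nonzero (unit ∘ el) (unit-≉0 ∘ el)) (begin
      Π * a ^ # (λ x → ¬? (x ≟ 0#))                              ≈⟨ *-comm _ _ ⟩
      a ^ # (λ x → ¬? (x ≟ 0#)) * Π                              ≈⟨ *-congʳ (∏-power (λ i → χ (¬? (el i ≟ 0#)))) ⟨
      ∏.sum (λ i → a ^ χ (¬? (el i ≟ 0#))) * Π                   ≈⟨ ∏.∑-distrib-+ {q} _ _ ⟨
      ∏.sum (λ i → a ^ χ (¬? (el i ≟ 0#)) * unit (el i))         ≈⟨ ∏.sum-cong-≋ {q} (λ i → unit-scale (el i) (el-index _)) ⟨
      ∏.sum (λ i → unit (el (scaling ⟨$⟩ʳ i)))                   ≈⟨ ∏.sum-permute (unit ∘ el) scaling ⟨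
      Π                                                          ≈⟨ *-identityʳ Π ⟨
      Π * 1#                                                     ∎)
      where
      Π = ∏.sum (unit ∘ el)

  fermat : ∀ {x} → x ∈ member F → x ^ q ≈ x
  fermat {x} x∈ with x ≟ 0#
  ... | no x≉0  = begin
    x ^ q                                   ≈⟨ ^-congʳ x #-nonzero ⟨
    x * x ^ # (λ x → ¬? (x ≟ 0#))           ≈⟨ *-congˡ (lagrange x≉0 x∈) ⟩
    x * 1#                                  ≈⟨ *-identityʳ x ⟩
    x                                       ∎
  ... | yes x≈0 = begin
    x ^ q                                   ≈⟨ ^-congʳ x #-nonzero ⟨
    x * x ^ # (λ x → ¬? (x ≟ 0#))           ≈⟨ *-congʳ x≈0 ⟩
    0# * x ^ # (λ x → ¬? (x ≟ 0#))          ≈⟨ zeroˡ _ ⟩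
    0#                                      ≈⟨ x≈0 ⟨
    x                                       ∎

  module _ {h : Carrier → Carrier} (h-cong : ∀ {x y} → x ≈ y → h x ≈ h y) (h-homo : ∀ x y → h (x + y) ≈ h x + h y)
    (h-closed : ∀ {x} → x ∈ member F → h x ∈ member F) where

    -- Translation by `a` carries the kernel of the additive map `h` onto the fibre over `h a`, so
    -- all nonempty fibres have the size of the kernel.
    rank-nullity : q ≡ # (λ x → h x ≟ 0#) ℕ.* # (Image? U? h)
    rank-nullity = ≡.trans (≡.sym (#-all U? (λ _ → tt))) (#-image-≡ U? h h-closed (# (λ x → h x ≟ 0#)) fibre)
      where
      fibre : ∀ i → _ → # (Fibre? U? h (h (el i))) ≡ # (λ x → h x ≟ 0#)
      fibre i _ = ≡.trans
        (#-permute {_+ a} {_- a} +-congʳ +-congʳ (λ x∈ → +-closed x∈ (el∈ i)) (λ x∈ → +-closed x∈ (neg-closed (el∈ i)))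
          (//-rightDividesˡ a) (//-rightDividesʳ a)
          (Fibre? U? h (h a)) (λ x≈y (_ , hx≈ha) → _ , trans (h-cong (sym x≈y)) hx≈ha))
        (#-cong (Fibre? U? h (h a) ∘ (_+ a)) (λ x → h x ≟ 0#)
          (λ j (_ , eq) → identityˡ-unique _ (h a) (trans (sym (h-homo _ a)) eq))
          (λ j hx≈0 → _ , trans (h-homo _ a) (trans (+-congʳ hx≈0) (+-identityˡ _))))
        where a = el i

  Fixed? : ∀ n → U.Decidable (λ x → x ^ n ≈ x)
  Fixed? n x = x ^ n ≟ x

  RootOfUnity? : ∀ n → U.Decidable (λ x → x ^ n ≈ 1#)
  RootOfUnity? n x = x ^ n ≟ 1#

  -- The equation `x ^ (n + 2) = x` splits into `x = 0` and `x ^ (n + 1) = 1`, which exclude each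
  -- other.
  #-fixed : ∀ n → # (Fixed? (suc (suc n))) ≡ suc (# (RootOfUnity? (suc n)))
  #-fixed n = ≡.trans (ℕ.≤-antisym
    (#-≤-cover (Fixed? (suc (suc n))) (_≟ 0#) (RootOfUnity? (suc n)) λ i → split (el i))
    (#-≥-disjoint (Fixed? (suc (suc n))) (_≟ 0#) (RootOfUnity? (suc n))
      (λ i x≈0 → trans (^-zero (suc n) x≈0) (sym x≈0))
      (λ i xⁿ≈1 → trans (*-congˡ xⁿ≈1) (*-identityʳ _))
      (λ i x≈0 xⁿ≈1 → rootOfUnity≉0 n xⁿ≈1 x≈0)))
    (≡.cong (ℕ._+ # (RootOfUnity? (suc n))) #-zero)
    where
    split : ∀ x → x ^ suc (suc n) ≈ x → x ≈ 0# ⊎ x ^ suc n ≈ 1#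
    split x fixed with x ≟ 0#
    ... | yes x≈0 = inj₁ x≈0
    ... | no x≉0  = inj₂ (*-cancelˡ x≉0 (trans fixed (sym (*-identityʳ x))))

  -- The witness `m` is the geometric sum `((1 + s) ^ k - 1) / s`.
  geometric : ∀ s k → ∃ λ m → suc s ℕ.^ k ≡ suc (m ℕ.* s)
  geometric s zero    = 0 , ≡.refl
  geometric s (suc k) with m , eq ← geometric s k =
    suc (m ℕ.+ s ℕ.* m) , ≡.trans (≡.cong (suc s ℕ.*_) eq)
      (solve 2 (λ s m → (con 1 :+ s) :* (con 1 :+ m :* s) := con 1 :+ (con 1 :+ (m :+ s :* m)) :* s) ≡.refl s m)
    where open +-*-Solver

  -- The power map with exponent (q − 1) / s has fibres of size at most (q − 1) / s
  -- and its values are fixed by x ↦ x ^ (1 + s), so there are more than s such fixed points.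
  #-fixed-≥ : ∀ s k → q ≡ suc s ℕ.^ k → suc s ≤ # (Fixed? (suc s))
  #-fixed-≥ s k q≡ with geometric s k
  ... | zero  , eq = contradiction (≡.trans q≡ eq) (ℕ.>⇒≢ 1<q)
  -- Since `q = 1 + (m + 1) * s`, the bound `q ≤ (m + 1) * f`, with `f` the number of fixed points,
  -- is the strict inequality `(m + 1) * s < (m + 1) * f`.
  ... | suc m , eq = ℕ.*-cancelˡ-< (suc m) s _ (≡.subst (ℕ._≤ suc m ℕ.* # (Fixed? (suc s))) (≡.trans q≡ eq) q≤)
    where
    power : Carrier → Carrier
    power = _^ suc m

    -- This rewriting makes a factor `x ^ q` appear, to which Fermat applies.
    exponent : suc m ℕ.* suc s ≡ m ℕ.+ q
    exponent = ≡.trans (ℕ.*-suc (suc m) s)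
      (≡.trans (≡.sym (ℕ.+-suc m _)) (≡.cong (m ℕ.+_) (≡.sym (≡.trans q≡ eq))))

    fixed : ∀ {x} → x ∈ member F → (x ^ suc m) ^ suc s ≈ x ^ suc m
    fixed {x} x∈ = begin
      (x ^ suc m) ^ suc s        ≈⟨ ^-assocʳ x (suc m) (suc s) ⟩
      x ^ (suc m ℕ.* suc s)      ≈⟨ ^-congʳ x exponent ⟩
      x ^ (m ℕ.+ q)              ≈⟨ ^-homo-* x m q ⟩
      x ^ m * x ^ q              ≈⟨ *-congˡ (fermat x∈) ⟩
      x ^ m * x                  ≈⟨ *-comm _ _ ⟩
      x ^ suc m                  ∎

    q≤ : q ≤ suc m ℕ.* # (Fixed? (suc s))
    q≤ = ≡.subst (_≤ suc m ℕ.* # (Fixed? (suc s))) (#-all U? (λ _ → tt)) (ℕ.≤-trans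
      (#-image-≤ U? power (^-closed (suc m)) (suc m) (λ i _ → ℕ.≤-trans
        (#-mono (Fibre? U? power _) (λ x → x ^ suc m ≟ power (el i)) (λ _ → proj₂)) (#-power m _)))
      (ℕ.*-monoʳ-≤ (suc m) (#-mono (Image? U? power) (Fixed? (suc s))
        λ j (i , _ , eq) → trans (^-congˡ (suc s) (sym eq)) (trans (fixed (el∈ i)) eq))))

  #-fixed-≡ : ∀ s k → q ≡ suc (suc s) ℕ.^ k → # (Fixed? (suc (suc s))) ≡ suc (suc s)
  #-fixed-≡ s k q≡ = ℕ.≤-antisym
    (≡.subst (_≤ suc (suc s)) (≡.sym (#-fixed s)) (s≤s (#-power s 1#))) (#-fixed-≥ (suc s) k q≡)

  fixed-iterate : ∀ {x} a → x ^ (p ℕ.^ a) ≈ x → ∀ k → x ^ (p ℕ.^ (k ℕ.* a)) ≈ x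
  fixed-iterate {x} a fixed zero    = *-identityʳ x
  fixed-iterate {x} a fixed (suc k) = begin
    x ^ (p ℕ.^ (a ℕ.+ k ℕ.* a))                ≈⟨ ^-congʳ x (ℕ.^-distribˡ-+-* p a (k ℕ.* a)) ⟩
    x ^ (p ℕ.^ a ℕ.* p ℕ.^ (k ℕ.* a))          ≈⟨ ^-assocʳ x (p ℕ.^ a) _ ⟨
    (x ^ (p ℕ.^ a)) ^ (p ℕ.^ (k ℕ.* a))        ≈⟨ ^-congˡ (p ℕ.^ (k ℕ.* a)) fixed ⟩
    x ^ (p ℕ.^ (k ℕ.* a))                      ≈⟨ fixed-iterate a fixed k ⟩
    x                                          ∎

  fixed-∣ : ∀ {x a b} → a ∣ b → x ^ (p ℕ.^ a) ≈ x → x ^ (p ℕ.^ b) ≈ x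
  fixed-∣ (divides k ≡.refl) fixed = fixed-iterate _ fixed k

  -- Replace `x` by `x ^ (p ^ b)` inside `x ^ (p ^ d)`: the exponents multiply to `p ^ a`.
  fixed-difference : ∀ {x} a b d → d ℕ.+ b ≡ a → x ^ (p ℕ.^ a) ≈ x → x ^ (p ℕ.^ b) ≈ x → x ^ (p ℕ.^ d) ≈ x
  fixed-difference {x} a b d eq fixᵃ fixᵇ = begin
    x ^ (p ℕ.^ d)                        ≈⟨ ^-congˡ (p ℕ.^ d) fixᵇ ⟨
    (x ^ (p ℕ.^ b)) ^ (p ℕ.^ d)          ≈⟨ ^-assocʳ x (p ℕ.^ b) (p ℕ.^ d) ⟩
    x ^ (p ℕ.^ b ℕ.* p ℕ.^ d)            ≈⟨ ^-congʳ x exponent ⟩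
    x ^ (p ℕ.^ a)                        ≈⟨ fixᵃ ⟩
    x                                    ∎
    where
    exponent : p ℕ.^ b ℕ.* p ℕ.^ d ≡ p ℕ.^ a
    exponent = ≡.trans (≡.sym (ℕ.^-distribˡ-+-* p b d)) (≡.cong (p ℕ.^_) (≡.trans (ℕ.+-comm b d) eq))

  -- Bézout over the naturals writes the gcd as a difference of a multiple of `a` and a multiple of
  -- `b`, in one order or the other.
  fixed-gcd : ∀ {x} a b → x ^ (p ℕ.^ a) ≈ x → x ^ (p ℕ.^ b) ≈ x → x ^ (p ℕ.^ gcd a b) ≈ x
  fixed-gcd a b fixᵃ fixᵇ with Bézout.identity (gcd-GCD a b)
  ... | Bézout.+- x y eq =
    fixed-difference (x ℕ.* a) (y ℕ.* b) (gcd a b) eq (fixed-iterate a fixᵃ x) (fixed-iterate b fixᵇ y)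
  ... | Bézout.-+ x y eq =
    fixed-difference (y ℕ.* b) (x ℕ.* a) (gcd a b) eq (fixed-iterate b fixᵇ y) (fixed-iterate a fixᵃ x)

-- The values missed by `Λ`.

module MissingValues {p c ℓ₁ ℓ₂} (p-prime : Prime p) {Ω : AlgebraicClosureOf𝔽 p c ℓ₁ ℓ₂} {q ℓ} (F : Subfield Ω q ℓ)
  (e n : ℕ) (N≡pᵉ : suc (suc n) ≡ p ℕ.^ e) where
  open AlgebraicClosureOf𝔽 Ω hiding (_×_; sum; zero) renaming (_≟_ to infix 4 _≟_)
  open CommutativeRing commutativeRing using (semiring; commutativeSemiring; +-abelianGroup)
  open import Algebra.Properties.Semiring.Exp semiring using (^-congˡ)
  open import Algebra.Properties.CommutativeSemiring.Exp commutativeSemiring using (^-distrib-*)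
  open import Algebra.Properties.AbelianGroup +-abelianGroup
    using (//-rightDividesˡ; //-rightDividesʳ; ⁻¹-∙-comm)
  open import Relation.Binary.Reasoning.Setoid setoid
  open FiniteField F
  open Subfield F hiding (member; order; elements)
  open Frobenius commutativeRing p-prime characteristic
  open RingIdentities commutativeRing

  private
    N : ℕ
    N = suc (suc n)

    ^N-homo-+ : ∀ x y → (x + y) ^ N ≈ x ^ N + y ^ N
    ^N-homo-+ = ≡.subst (λ k → ∀ x y → (x + y) ^ k ≈ x ^ k + y ^ k) (≡.sym N≡pᵉ) (^pᵏ-homo-+ e)

  -- For `w = 1 / (u - 1)`, the equation `Λ u = a` reads `A a w = 1`. This map is additive because
  -- `N` is a power of `p`.
  A : Carrier → Carrier → Carrier
  A a w = a * w ^ N - w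

  module _ (a : Carrier) where

    A-cong : ∀ {x y} → x ≈ y → A a x ≈ A a y
    A-cong x≈y = +-cong (*-congˡ (^-congˡ N x≈y)) (-‿cong x≈y)

    A-homo-+ : ∀ x y → A a (x + y) ≈ A a x + A a y
    A-homo-+ x y = trans
      (+-cong (*-congˡ (^N-homo-+ x y)) (sym (⁻¹-∙-comm x y)))
      (sum-difference a (x ^ N) (y ^ N) (- x) (- y))

    A-closed : a ∈ member F → ∀ {x} → x ∈ member F → A a x ∈ member F
    A-closed a∈ x∈ = +-closed (*-closed a∈ (^-closed N x∈)) (neg-closed x∈)

    A-intro : ∀ {w y} → a * w ^ N ≈ y + w → A a w ≈ y
    A-intro {w} {y} eq = trans (+-congʳ eq) (//-rightDividesʳ w y)

    A-elim : ∀ {w y} → A a w ≈ y → a * w ^ N ≈ y + w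
    A-elim {w} {y} eq = trans (sym (//-rightDividesˡ w _)) (+-congʳ eq)

  L : Carrier → Carrier
  L = A 1#

  L-intro : ∀ {z b} → z ^ N ≈ b + z → L z ≈ b
  L-intro eq = A-intro 1# (trans (*-identityˡ _) eq)

  L-elim : ∀ {z b} → L z ≈ b → z ^ N ≈ b + z
  L-elim eq = trans (sym (*-identityˡ _)) (A-elim 1# eq)

  ImL? : U.Decidable (Image U? L)
  ImL? = Image? U? L

  ImL-intro : ∀ {z b} → z ∈ member F → z ^ N ≈ b + z → Image U? L b
  ImL-intro z∈ eq = index z∈ , tt , trans (A-cong 1# (el-index z∈)) (L-intro eq)

  ImL-resp : Image U? L Respects _≈_
  ImL-resp x≈y (i , _ , eq) = i , tt , trans eq x≈y

  ImL-zero : ∀ {b} → b ≈ 0# → Image U? L b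
  ImL-zero b≈0 = ImL-intro 0∈ (trans (^-zero (suc n) refl) (sym (trans (+-identityʳ _) b≈0)))

  ImΛ? : U.Decidable (Image U? (Λ Ω N))
  ImΛ? = Image? U? (Λ Ω N)

  Λ-cong : ∀ {x y} → x ≈ y → Λ Ω N x ≈ Λ Ω N y
  Λ-cong x≈y = *-cong x≈y (^-congˡ (suc n) (+-congʳ x≈y))

  Λ-closed : ∀ {x} → x ∈ member F → Λ Ω N x ∈ member F
  Λ-closed x∈ = *-closed x∈ (^-closed (suc n) (+-closed x∈ (neg-closed 1∈)))

  ImΛ-intro : ∀ {v a} → v ∈ member F → (v + 1#) * v ^ suc n ≈ a → Image U? (Λ Ω N) a
  ImΛ-intro {v} v∈ eq = index u∈ , tt ,
    trans (Λ-cong (el-index u∈)) (trans (*-congˡ (^-congˡ (suc n) (//-rightDividesʳ 1# v))) eq)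
    where u∈ = +-closed v∈ 1∈

  -- The change of variable behind every transfer below. If `b ≠ 0` and `Λ u = b ^ (N - 1)`,
  -- cancelling that power leaves `z ^ N = b + z`, that is `L z = b`; for `b = 1` it is the
  -- substitution `z = 1 / (u - 1)`.
  Λ-rescale : ∀ {u v z b} → u ≈ v + 1# → v * z ≈ b → z ^ N * (u * v ^ suc n) ≈ (b + z) * b ^ suc n
  Λ-rescale {u} {v} {z} {b} u≈v+1 vz≈b = begin
    z ^ N * (u * v ^ suc n)                  ≈⟨ exchange z (z ^ suc n) u (v ^ suc n) ⟩
    (u * z) * (v ^ suc n * z ^ suc n)        ≈⟨ *-cong (trans (*-congʳ u≈v+1) (distribʳ z v 1#)) (sym (^-distrib-* v z (suc n))) ⟩
    (v * z + 1# * z) * (v * z) ^ suc n       ≈⟨ *-cong (+-cong vz≈b (*-identityˡ z)) (^-congˡ (suc n) vz≈b) ⟩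
    (b + z) * b ^ suc n                      ∎

  π : Carrier → Carrier
  π b = b ^ suc n

  ¬ImL? : U.Decidable (λ b → ¬ Image U? L b)
  ¬ImL? b = ¬? (ImL? b)

  ∉ImL⇒≉0 : ∀ {b} → ¬ Image U? L b → ¬ b ≈ 0#
  ∉ImL⇒≉0 b∉ b≈0 = b∉ (ImL-zero b≈0)

  -- If `a = b ^ (N - 1)` were also `Λ u`, then `z = b / (u - 1)` would satisfy `L z = b`. The case
  -- `u = 1` gives `a = 0`, which is impossible because 0 lies in the image of `L`, so `b ≠ 0`.
  missing⇐ : ∀ {a} → Image ¬ImL? π a → ¬ Image U? (Λ Ω N) a
  missing⇐ {a} (i , b∉ , bⁿ≈a) (j , _ , Λu≈a) with el j - 1# ≟ 0#
  ... | yes v≈0 = ^-nonzero (suc n) (∉ImL⇒≉0 b∉) (trans bⁿ≈a (trans (sym Λu≈a) (trans (*-congˡ (^-zero n v≈0)) (zeroʳ _))))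
  ... | no v≉0 with w , vw≈1 ← inverse v≉0 = b∉ (ImL-intro z∈ (*-cancelˡ (^-nonzero (suc n) (∉ImL⇒≉0 b∉)) (begin
    b ^ suc n * z ^ N                    ≈⟨ *-comm _ _ ⟩
    z ^ N * b ^ suc n                    ≈⟨ *-congˡ (trans bⁿ≈a (sym Λu≈a)) ⟩
    z ^ N * Λ Ω N u                      ≈⟨ Λ-rescale (sym (//-rightDividesˡ 1# u)) vz≈b ⟩
    (b + z) * b ^ suc n                  ≈⟨ *-comm _ _ ⟩
    b ^ suc n * (b + z)                  ∎)))
    where
    b = el i
    u = el j
    z = w * b
    vz≈b : (u - 1#) * z ≈ b
    vz≈b = trans (sym (*-assoc _ w b)) (trans (*-congʳ vw≈1) (*-identityˡ b))
    z∈ : z ∈ member F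
    z∈ = *-closed (inv-closed (+-closed (el∈ j) (neg-closed 1∈)) vw≈1) (el∈ i)

  -- If A a is injective then it is onto and attains 1, so that a is a value of Λ;
  -- otherwise a nonzero w with A a w = 0 gives a = (1 / w) ^ (N − 1).
  missing⇒ : ∀ {a} → a ∈ member F → ¬ Image U? (Λ Ω N) a → Image ¬ImL? π a
  missing⇒ {a} a∈ a∉ with Fin.any? (λ i → ¬? (el i ≟ 0#) ×-dec (A a (el i) ≟ 0#))
  ... | yes (i , w≉0 , Aw≈0) with b , wb≈1 ← inverse w≉0 = index b∈ , b∉ , trans (^-congˡ (suc n) (el-index b∈)) bⁿ≈a
    where
    w = el i
    b∈ : b ∈ member F
    b∈ = inv-closed (el∈ i) wb≈1
    awⁿ≈1 : a * w ^ suc n ≈ 1#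
    awⁿ≈1 = *-cancelˡ w≉0 (begin
      w * (a * w ^ suc n)      ≈⟨ *-assoc w a _ ⟨
      w * a * w ^ suc n        ≈⟨ *-congʳ (*-comm w a) ⟩
      a * w * w ^ suc n        ≈⟨ *-assoc a w _ ⟩
      a * w ^ N                ≈⟨ A-elim a Aw≈0 ⟩
      0# + w                   ≈⟨ +-identityˡ w ⟩
      w                        ≈⟨ *-identityʳ w ⟨
      w * 1#                   ∎)
    bⁿ≈a : b ^ suc n ≈ a
    bⁿ≈a = begin
      b ^ suc n                      ≈⟨ *-identityˡ _ ⟨
      1# * b ^ suc n                 ≈⟨ *-congʳ awⁿ≈1 ⟨
      a * w ^ suc n * b ^ suc n      ≈⟨ *-assoc a _ _ ⟩
      a * (w ^ suc n * b ^ suc n)    ≈⟨ *-congˡ (^-distrib-* w b (suc n)) ⟨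
      a * (w * b) ^ suc n            ≈⟨ *-congˡ (trans (^-congˡ (suc n) wb≈1) (1^n≈1 (suc n))) ⟩
      a * 1#                         ≈⟨ *-identityʳ a ⟩
      a                              ∎
    b≉0 : ¬ b ≈ 0#
    b≉0 = unit≉0 (trans (*-comm b w) wb≈1)
    -- If `L z = b`, then `z ≠ 0` because `b ≠ 0`, and `v = b / z` makes `a` the value of `Λ` at
    -- `v + 1`.
    b∉ : ¬ Image U? L (el (index b∈))
    b∉ (k , _ , Lz≈b′) with inverse z≉0
      where
      zᴺ≈b+z : el k ^ N ≈ b + el k
      zᴺ≈b+z = L-elim (trans Lz≈b′ (el-index b∈))
      z≉0 : ¬ el k ≈ 0#
      z≉0 z≈0 = b≉0 (trans (sym (trans (+-congˡ z≈0) (+-identityʳ b))) (trans (sym zᴺ≈b+z) (^-zero (suc n) z≈0)))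
    ... | y , zy≈1 = a∉ (ImΛ-intro v∈ (*-cancelˡ (^-nonzero N (unit≉0 zy≈1)) (begin
      z ^ N * ((v + 1#) * v ^ suc n)       ≈⟨ Λ-rescale refl vz≈b ⟩
      (b + z) * b ^ suc n                  ≈⟨ *-cong (sym zᴺ≈b+z) bⁿ≈a ⟩
      z ^ N * a                            ∎)))
      where
      z = el k
      v = b * y
      zᴺ≈b+z : z ^ N ≈ b + z
      zᴺ≈b+z = L-elim (trans Lz≈b′ (el-index b∈))
      v∈ : v ∈ member F
      v∈ = *-closed b∈ (inv-closed (el∈ k) zy≈1)
      vz≈b : v * z ≈ b
      vz≈b = trans (*-assoc b y z) (trans (*-congˡ (trans (*-comm y z) zy≈1)) (*-identityʳ b))
  ... | no trivial with 1-attained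
    where
    -- With a trivial kernel, rank-nullity gives the image of `A a` all `q` elements, so 1 is
    -- attained.
    #ker≡1 : # (λ x → A a x ≟ 0#) ≡ 1
    #ker≡1 = ≡.trans (#-cong (λ x → A a x ≟ 0#) (_≟ 0#) only-zero (λ i x≈0 → A-intro a (begin
        a * el i ^ N     ≈⟨ *-congˡ (^-zero (suc n) x≈0) ⟩
        a * 0#           ≈⟨ zeroʳ a ⟩
        0#               ≈⟨ x≈0 ⟨
        el i             ≈⟨ +-identityˡ _ ⟨
        0# + el i        ∎))) #-zero
      where
      only-zero : ∀ i → A a (el i) ≈ 0# → el i ≈ 0#
      only-zero i Ax≈0 with el i ≟ 0#
      ... | yes x≈0 = x≈0
      ... | no x≉0  = contradiction (i , x≉0 , Ax≈0) trivial
    1-attained : Image U? (A a) (el (index 1∈))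
    1-attained = #-full (Image? U? (A a)) (≡.sym (≡.trans (rank-nullity (A-cong a) (A-homo-+ a) (A-closed a a∈))
      (≡.trans (≡.cong (ℕ._* # (Image? U? (A a))) #ker≡1) (ℕ.*-identityˡ _)))) (index 1∈)
  ... | i , _ , Aw≈1 with inverse w≉0
    where
    w≉0 : ¬ el i ≈ 0#
    w≉0 w≈0 = 1≉0 (begin
      1#               ≈⟨ el-index 1∈ ⟨
      el (index 1∈)    ≈⟨ +-identityʳ _ ⟨
      _ + 0#           ≈⟨ +-congˡ w≈0 ⟨
      _ + el i         ≈⟨ A-elim a Aw≈1 ⟨
      a * el i ^ N     ≈⟨ *-congˡ (^-zero (suc n) w≈0) ⟩
      a * 0#           ≈⟨ zeroʳ a ⟩
      0#               ∎)
  -- Rescaling with `b = 1`: the argument `1 + 1 / w` is sent to `a` by `Λ`.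
  ... | v , wv≈1 = contradiction (ImΛ-intro (inv-closed (el∈ i) wv≈1) (*-cancelˡ (^-nonzero N (unit≉0 wv≈1)) (begin
    w ^ N * ((v + 1#) * v ^ suc n)       ≈⟨ Λ-rescale refl (trans (*-comm v w) wv≈1) ⟩
    (1# + w) * 1# ^ suc n                ≈⟨ *-congˡ (1^n≈1 (suc n)) ⟩
    (1# + w) * 1#                        ≈⟨ *-identityʳ _ ⟩
    1# + w                               ≈⟨ +-congʳ (el-index 1∈) ⟨
    el (index 1∈) + w                    ≈⟨ A-elim a Aw≈1 ⟨
    a * w ^ N                            ≈⟨ *-comm _ _ ⟩
    w ^ N * a                            ∎))) a∉
    where
    w = el i

  -- From `ζ ^ (N - 1) = 1` follows `L (z / ζ) = L z / ζ`. Hence the complement of the image of `L`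
  -- is stable under multiplication by these roots of unity.
  ImL-unscale : ∀ {b ζ} → ζ ∈ member F → ζ ^ suc n ≈ 1# → Image U? L (b * ζ) → Image U? L b
  ImL-unscale {b} {ζ} ζ∈ ζⁿ≈1 (i , _ , Lz≈bζ) with ω , ζω≈1 ← inverse (rootOfUnity≉0 n ζⁿ≈1) =
    ImL-intro (*-closed (el∈ i) (inv-closed ζ∈ ζω≈1)) (begin
    (z * ω) ^ N                                ≈⟨ ^-distrib-* z ω N ⟩
    z ^ N * (ω * ω ^ suc n)                    ≈⟨ *-cong (L-elim Lz≈bζ) refl ⟩
    (b * ζ + z) * (ω * ω ^ suc n)              ≈⟨ *-assoc _ ω _ ⟨
    (b * ζ + z) * ω * ω ^ suc n                ≈⟨ *-congʳ (trans (distribʳ ω (b * ζ) z) (+-congʳ (*-assoc b ζ ω))) ⟩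
    (b * (ζ * ω) + z * ω) * ω ^ suc n          ≈⟨ *-cong (+-congʳ (trans (*-congˡ ζω≈1) (*-identityʳ b))) ωⁿ≈1 ⟩
    (b + z * ω) * 1#                           ≈⟨ *-identityʳ _ ⟩
    b + z * ω                                  ∎)
    where
    z = el i
    ωⁿ≈1 : ω ^ suc n ≈ 1#
    ωⁿ≈1 = begin
      ω ^ suc n                    ≈⟨ *-identityˡ _ ⟨
      1# * ω ^ suc n               ≈⟨ *-congʳ ζⁿ≈1 ⟨
      ζ ^ suc n * ω ^ suc n        ≈⟨ ^-distrib-* ζ ω (suc n) ⟨
      (ζ * ω) ^ suc n              ≈⟨ ^-congˡ (suc n) ζω≈1 ⟩
      1# ^ suc n                   ≈⟨ 1^n≈1 (suc n) ⟩
      1#                           ∎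

  -- By that stability, each nonempty fibre of `π` on the complement is a full coset `b * ζ`, with
  -- `ζ` running over the `(N - 1)`-st roots of unity in `F`.
  #-¬ImL : # ¬ImL? ≡ # (RootOfUnity? (suc n)) ℕ.* # (Image? ¬ImL? π)
  #-¬ImL = #-image-≡ ¬ImL? π (^-closed (suc n)) (# (RootOfUnity? (suc n))) fibre
    where
    fibre : ∀ i → ¬ Image U? L (el i) → # (Fibre? ¬ImL? π (π (el i))) ≡ # (RootOfUnity? (suc n))
    fibre i b∉ = ≡.trans
      (#-scale (∉ImL⇒≉0 b∉) (el∈ i) (Fibre? ¬ImL? π (π b))
        (λ x≈y (x∉ , eq) → (x∉ ∘ ImL-resp (sym x≈y)) , trans (^-congˡ (suc n) (sym x≈y)) eq))
      (#-cong (Fibre? ¬ImL? π (π b) ∘ (b *_)) (RootOfUnity? (suc n))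
        (λ j (_ , eq) → *-cancelˡ (^-nonzero (suc n) (∉ImL⇒≉0 b∉))
          (trans (sym (^-distrib-* b (el j) (suc n))) (trans eq (sym (*-identityʳ _)))))
        (λ j ζⁿ≈1 → b∉ ∘ ImL-unscale (el∈ j) ζⁿ≈1 ,
          trans (^-distrib-* b (el j) (suc n)) (trans (*-congˡ ζⁿ≈1) (*-identityʳ _))))
      where b = el i

  #-missing : # (λ a → ¬? (ImΛ? a)) ≡ # (Image? ¬ImL? π)
  #-missing = #-cong (λ a → ¬? (ImΛ? a)) (Image? ¬ImL? π) (λ i → missing⇒ (el∈ i)) (λ i → missing⇐)

  #-kernel : # (λ x → L x ≟ 0#) ≡ # (Fixed? N)
  #-kernel = #-cong (λ x → L x ≟ 0#) (Fixed? N)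
    (λ i eq → trans (L-elim eq) (+-identityˡ _)) (λ i eq → L-intro (trans eq (sym (+-identityˡ _))))

  module _ {s} (#fixed : # (Fixed? N) ≡ suc s) .{{_ : NonZero s}} where

    order-ImL : q ≡ suc s ℕ.* # ImL?
    order-ImL = ≡.trans
      (rank-nullity (A-cong 1#) (A-homo-+ 1#) (A-closed 1# 1∈))
      (≡.cong (ℕ._* # ImL?) (≡.trans #-kernel #fixed))

    -- Here `s` is one less than the number of fixed points, hence the number of roots of unity.
    -- With `r` the size of the image of `L`, the complement has `(1 + s) * r - r = s * r` elements
    -- and also `s` times the number of missing values; cancel `s`.
    #-missing≡#-ImL : # (λ a → ¬? (ImΛ? a)) ≡ # ImL?
    #-missing≡#-ImL = ≡.trans #-missing (ℕ.*-cancelˡ-≡ _ _ s (ℕ.+-cancelˡ-≡ (# ImL?) _ _ (≡.trans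
      (≡.cong (# ImL? ℕ.+_) (≡.sym (≡.trans #-¬ImL (≡.cong (ℕ._* # (Image? ¬ImL? π)) #units))))
      (≡.trans (#-complement ImL?) order-ImL))))
      where
      #units : # (RootOfUnity? (suc n)) ≡ s
      #units = ℕ.suc-injective (≡.trans (≡.sym (#-fixed n)) #fixed)

    #-ImΛ : # ImΛ? ℕ.+ # ImL? ≡ q
    #-ImΛ = ≡.trans (≡.cong (# ImΛ? ℕ.+_) (≡.sym #-missing≡#-ImL)) (#-complement ImΛ?)

-- Containment of subfields in terms of fixed points.

module Subfields {p c ℓ₁ ℓ₂} {Ω : AlgebraicClosureOf𝔽 p c ℓ₁ ℓ₂}
  {Q ℓ₃} (𝔽Q : Subfield Ω Q ℓ₃) {n ℓ₄} (𝔽N : Subfield Ω (suc (suc n)) ℓ₄) where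
  open AlgebraicClosureOf𝔽 Ω hiding (_×_; sum; zero) renaming (_≟_ to infix 4 _≟_)
  open CommutativeRing commutativeRing using (semiring)
  open import Algebra.Properties.Semiring.Exp semiring using (^-congˡ)
  open FiniteField 𝔽Q
  private
    module N = FiniteField 𝔽N
    N : ℕ
    N = suc (suc n)

  -- Fermat in the smaller field makes its `N` distinct elements fixed points lying in the larger
  -- one.
  ⊆⇒#-fixed : member 𝔽N U.⊆ member 𝔽Q → N ≤ # (Fixed? N)
  ⊆⇒#-fixed 𝔽N⊆𝔽Q = ≡.subst (_≤ # (Fixed? N))
    (≡.trans (#-listed unique (All.map⁺ (All.tabulate⁺ λ i → 𝔽N⊆𝔽Q (N.el∈ i)))) N.length-elements)
    (#-mono (Listed? (Subfield.elements 𝔽N)) (Fixed? N) λ _ listed →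
      let (i , x≈) = Any.satisfied (Any.map⁻ listed) in fixed x≈ (N.el∈ i))
    where
    fixed : ∀ {x y} → x ≈ y → y ∈ member 𝔽N → x ^ N ≈ x
    fixed x≈y y∈ = trans (^-congˡ N x≈y) (trans (N.fermat y∈) (sym x≈y))
    unique : Unique setoid (Subfield.elements 𝔽N)
    unique = Unique.map⁺ (≡.setoid (Fin N)) setoid N.el-injective (allFin⁺ N)

  -- An element of `𝔽N` outside `𝔽Q` is nonzero, hence an `(N - 1)`-st root of unity; it would leave
  -- room for at most `N - 2` of them in `𝔽Q`, which has `N - 1`.
  #-fixed⇒⊆ : # (Fixed? N) ≡ N → member 𝔽N U.⊆ member 𝔽Q
  #-fixed⇒⊆ #fixed≡N {x} x∈𝔽N with member? x
  ... | yes x∈𝔽Q = x∈𝔽Q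
  ... | no x∉𝔽Q  = contradiction (≡.subst (_≤ n) #units≡n+1 (#-power-∉ n x∉𝔽Q xⁿ≈1)) ℕ.1+n≰n
    where
    #units≡n+1 : # (RootOfUnity? (suc n)) ≡ suc n
    #units≡n+1 = ℕ.suc-injective (≡.trans (≡.sym (#-fixed n)) #fixed≡N)
    x≉0 : ¬ x ≈ 0#
    x≉0 x≈0 = x∉𝔽Q (Subfield.resp 𝔽Q (sym x≈0) (Subfield.0∈ 𝔽Q))
    xⁿ≈1 : x ^ suc n ≈ 1#
    xⁿ≈1 = *-cancelˡ x≉0 (trans (N.fermat x∈𝔽N) (sym (*-identityʳ x)))

-- The ceiling of `(k * N - 1) / N`.

module Ceiling where
  open import Data.Nat.Base using (_+_; _*_; _/_; _%_)

  -[1+]/ℕ : ∀ t d .{{_ : NonZero d}} {r} → suc t % d ≡ suc r → ℤ.-[1+ t ] ℤ./ℕ d ≡ ℤ.-[1+ suc t / d ]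
  -[1+]/ℕ t d eq with suc t % d
  -[1+]/ℕ t d () | zero
  -[1+]/ℕ t d eq | suc _ = ≡.refl

  -- The ceiling is minus the floor of the opposite. As `k * N - 1` has quotient `k - 1` and nonzero
  -- remainder `N - 1`, that floor is `-k`.
  ceiling-[kN-1]/N : ∀ k n .{{_ : NonZero k}} .{{_ : NonZero (suc (suc n))}} →
    ceiling ((ℤ.+ (k * suc (suc n)) ℤ.- ℤ.1ℤ) ℚ./ suc (suc n)) ≡ ℤ.+ k
  ceiling-[kN-1]/N (suc k) n = begin
    ceiling (ℚ.normalize t N)                           ≡⟨ ≡.cong ceiling (ℚ.normalize-coprime {t} {suc n} coprime) ⟩
    ℤ.- (ℤ.1ℤ ℤ.* (ℤ.-[1+ n + k * N ] ℤ./ℕ N))            ≡⟨ ≡.cong ℤ.-_ (ℤ.*-identityˡ _) ⟩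
    ℤ.- (ℤ.-[1+ n + k * N ] ℤ./ℕ N)                       ≡⟨ ≡.cong ℤ.-_ (-[1+]/ℕ (n + k * N) N remainder) ⟩
    ℤ.+ suc (t / N)                                       ≡⟨ ≡.cong (ℤ.+_ ∘ suc) quotient ⟩
    ℤ.+ suc k                                             ∎
    where
    open ≡.≡-Reasoning
    N t : ℕ
    N = suc (suc n)
    t = suc n + k * N
    n<N : suc n < N
    n<N = ℕ.n<1+n (suc n)
    remainder : t % N ≡ suc n
    remainder = ≡.trans ([m+kn]%n≡m%n (suc n) k N) (m<n⇒m%n≡m n<N)
    quotient : t / N ≡ k
    quotient = ≡.trans (+-distrib-/-∣ʳ (suc n) (divides k ≡.refl)) (≡.cong₂ _+_ (m<n⇒m/n≡0 n<N) (m*n/n≡m k N))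
    -- A common divisor divides both `t` and `t + 1`, the latter being a multiple of `N`; so
    -- normalising the fraction changes nothing.
    coprime : Coprime t N
    coprime {d} (d∣t , d∣N) = ∣1⇒≡1 (∣m+n∣m⇒∣n (≡.subst (d ∣_) (ℕ.+-comm 1 t) (∣-trans d∣N (divides (suc k) ≡.refl))) d∣t)

-- Prime-power bounds and the final computation.

2≤p^ : ∀ {p k} → Prime p → 1 ≤ k → 2 ≤ p ℕ.^ k
2≤p^ {p} {k} p-prime 1≤k = ℕ.≤-trans 2≤p (≡.subst (_≤ p ℕ.^ k) (ℕ.^-identityʳ p) (ℕ.^-monoʳ-≤ p 1≤k))
  where
  instance
    _ = prime⇒nonTrivial p-prime
    _ = ℕ.nonTrivial⇒nonZero p
  2≤p : 2 ≤ p
  2≤p = ℕ.nonTrivial⇒n>1 p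

^-cancelʳ-≤ : ∀ p → 1 < p → ∀ {a b} → p ℕ.^ a ≤ p ℕ.^ b → a ≤ b
^-cancelʳ-≤ p 1<p {a} {b} pᵃ≤pᵇ with a ℕ.≤? b
... | yes a≤b = a≤b
... | no a≰b  = contradiction pᵃ≤pᵇ (ℕ.<⇒≱ (ℕ.^-monoʳ-< p 1<p (ℕ.≰⇒> a≰b)))

module Excess {p c ℓ₁ ℓ₂} (p-prime : Prime p) {Ω : AlgebraicClosureOf𝔽 p c ℓ₁ ℓ₂} {e m n s : ℕ}
  (N≡ : suc (suc n) ≡ p ℕ.^ e) (s≡ : suc (suc s) ≡ p ℕ.^ gcd e m) (e≤m : e ≤ m)
  {Q ℓ} (Q≡ : Q ≡ p ℕ.^ m) (F : Subfield Ω Q ℓ) where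
  open FiniteField F
  open MissingValues p-prime F e n N≡

  N S r k : ℕ
  N = suc (suc n)
  S = suc (suc s)
  r = # ImL?
  k = p ℕ.^ (m ∸ e)

  p≢0 : NonZero p
  p≢0 = ℕ.nonTrivial⇒nonZero p {{prime⇒nonTrivial p-prime}}

  k≢0 : NonZero k
  k≢0 = ℕ.m^n≢0 p (m ∸ e) {{p≢0}}

  Q≡kN : Q ≡ k ℕ.* N
  Q≡kN = ≡.trans Q≡ (≡.trans (≡.cong (p ℕ.^_) (≡.sym (ℕ.m∸n+n≡m e≤m)))
    (≡.trans (ℕ.^-distribˡ-+-* p (m ∸ e) e) (≡.cong (k ℕ.*_) (≡.sym N≡))))

  -- Elements of `F` are fixed by the exponent `p ^ m` anyway, so exponent `p ^ e` may be traded for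
  -- `p ^ gcd e m`. Unlike `N`, the number `S` always has `Q` among its powers.
  #-fixed-gcd : # (Fixed? N) ≡ # (Fixed? S)
  #-fixed-gcd = ≡.subst₂ (λ N S → # (Fixed? N) ≡ # (Fixed? S)) (≡.sym N≡) (≡.sym s≡)
    (#-cong (Fixed? (p ℕ.^ e)) (Fixed? (p ℕ.^ gcd e m))
      (λ i fixed → fixed-gcd e m fixed (≡.subst (λ Q → el i ^ Q ≈ el i) Q≡ (fermat (el∈ i))))
      (λ i → fixed-∣ (gcd[m,n]∣m e m)))
    where open AlgebraicClosureOf𝔽 Ω using (_^_; _≈_)

  #-fixed-N : # (Fixed? N) ≡ S
  -- Here `j = m / gcd e m`, so that `Q = S ^ j`.
  #-fixed-N with divides j m≡ ← gcd[m,n]∣n e m = ≡.trans #-fixed-gcd (#-fixed-≡ s j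
    (≡.trans Q≡ (≡.trans (≡.cong (p ℕ.^_) (≡.trans m≡ (ℕ.*-comm j _)))
      (≡.trans (≡.sym (ℕ.^-*-assoc p (gcd e m) j)) (≡.cong (ℕ._^ j) (≡.sym s≡))))))

  Q≡Sr : Q ≡ S ℕ.* r
  Q≡Sr = order-ImL #-fixed-N

  #image+r≡Q : #image Ω (Λ Ω N) F ℕ.+ r ≡ Q
  #image+r≡Q = ≡.trans (≡.cong (ℕ._+ r) (#image-≡-#Image Λ-closed)) (#-ImΛ #-fixed-N)

  -- Both `S * r` and `k * N` equal `Q`, so equality of one pair of factors forces that of the
  -- other.
  r≡k⇔S≡N : (r ≡ k → S ≡ N) × (S ≡ N → r ≡ k)
  r≡k⇔S≡N = (λ r≡k → ℕ.*-cancelʳ-≡ S N k {{k≢0}} (≡.trans (≡.cong (S ℕ.*_) (≡.sym r≡k)) (≡.trans Sr≡kN (ℕ.*-comm k N)))) ,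
            (λ S≡N → ℕ.*-cancelˡ-≡ r k N (≡.trans (≡.cong (ℕ._* r) (≡.sym S≡N)) (≡.trans Sr≡kN (ℕ.*-comm k N))))
    where Sr≡kN = ≡.trans (≡.sym Q≡Sr) Q≡kN

  S≤N : S ≤ N
  S≤N = ≡.subst (_≤ N) (≡.trans (≡.sym (#-fixed n)) #-fixed-N) (s≤s (#-power n _))

  Q/S≡r : Q ℕ./ S ≡ r
  Q/S≡r = ≡.trans (≡.cong (ℕ._/ S) (≡.trans Q≡Sr (ℕ.*-comm S r))) (m*n/n≡m r S)

  C : ℤ
  C = ceiling ((ℤ.+ Q ℤ.- ℤ.1ℤ) ℚ./ N)

  C≡k : C ≡ ℤ.+ k
  C≡k = ≡.trans (≡.cong (λ Q → ceiling ((ℤ.+ Q ℤ.- ℤ.1ℤ) ℚ./ N)) Q≡kN) (Ceiling.ceiling-[kN-1]/N k n {{k≢0}})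

  excess : (ℤ.+ Q ℤ.- C) ℤ.- ℤ.+ #image Ω (Λ Ω N) F ≡ ℤ.+ (Q ℕ./ S) ℤ.- C
  -- Only the explicit `Q` is replaced by image size plus `r`; the occurrence inside `C` stays, so
  -- `C` is carried along as an opaque integer.
  excess = ≡.trans (≡.cong (λ Q → (ℤ.+ Q ℤ.- C) ℤ.- ℤ.+ #image Ω (Λ Ω N) F) (≡.sym #image+r≡Q))
    (≡.trans (rearrange (ℤ.+ #image Ω (Λ Ω N) F) (ℤ.+ r) C) (≡.cong (λ r → ℤ.+ r ℤ.- C) (≡.sym Q/S≡r)))
    where
    rearrange : ∀ I r C → (I ℤ.+ r ℤ.- C) ℤ.- I ≡ r ℤ.- C
    rearrange = ℤ-Solver.solve-∀

  -- The excess is `r - k`, so it vanishes exactly when `S = N`, that is when `F` contains `N`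
  -- solutions of `x ^ N = x`.
  excess≡0⇔⊆ : ∀ {ℓ′} (𝔽N : Subfield Ω N ℓ′) →
    ((ℤ.+ Q ℤ.- C) ℤ.- ℤ.+ #image Ω (Λ Ω N) F ≡ ℤ.0ℤ) ⇔ (member 𝔽N U.⊆ member F)
  excess≡0⇔⊆ 𝔽N = mk⇔ to from
    where
    open Subfields F 𝔽N
    r-k : (ℤ.+ Q ℤ.- C) ℤ.- ℤ.+ #image Ω (Λ Ω N) F ≡ ℤ.+ r ℤ.- ℤ.+ k
    r-k = ≡.trans excess (≡.cong₂ (λ r c → ℤ.+ r ℤ.- c) Q/S≡r C≡k)
    to : (ℤ.+ Q ℤ.- C) ℤ.- ℤ.+ #image Ω (Λ Ω N) F ≡ ℤ.0ℤ → member 𝔽N U.⊆ member F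
    to excess≡0 = #-fixed⇒⊆
      (≡.trans #-fixed-N (proj₁ r≡k⇔S≡N (ℤ.+-injective (ℤ.i-j≡0⇒i≡j _ _ (≡.trans (≡.sym r-k) excess≡0)))))
    from : member 𝔽N U.⊆ member F → (ℤ.+ Q ℤ.- C) ℤ.- ℤ.+ #image Ω (Λ Ω N) F ≡ ℤ.0ℤ
    from 𝔽N⊆F = ≡.trans r-k
      (ℤ.i≡j⇒i-j≡0 (≡.cong ℤ.+_ (proj₂ r≡k⇔S≡N (ℕ.≤-antisym S≤N (≡.subst (N ≤_) #-fixed-N (⊆⇒#-fixed 𝔽N⊆F))))))

open import Data.Integer.Base using (+_; _-_; 0ℤ; 1ℤ)
open import Data.Nat.Base using (_^_; _/_)
open import Relation.Unary using (_⊆_)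

corollary5p7 : ∀ {c ℓ₁ ℓ₂ ℓ₃ ℓ₄} (p : ℕ) → Prime p →
    (Ω : AlgebraicClosureOf𝔽 p c ℓ₁ ℓ₂) →
    (e m N Q s : ℕ) .{{_ : NonZero N}} .{{_ : NonZero s}} →
    1 ≤ e → N ≡ p ^ e →
    1 ≤ m → Q ≡ p ^ m → N ≤ Q →
    s ≡ p ^ gcd e m →
    (𝔽Q : Subfield Ω Q ℓ₃) →
    ((+ Q - ceiling ((+ Q - 1ℤ) ℚ./ N)) - + #image Ω (Λ Ω N) 𝔽Q
    ≡ + (Q / s) - ceiling ((+ Q - 1ℤ) ℚ./ N))
    × ((𝔽N : Subfield Ω N ℓ₄) →
    ((+ Q - ceiling ((+ Q - 1ℤ) ℚ./ N)) - + #image Ω (Λ Ω N) 𝔽Q ≡ 0ℤ)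
    ⇔ (member 𝔽N ⊆ member 𝔽Q))
corollary5p7 {c} {ℓ₁} {ℓ₂} {ℓ₃} {ℓ₄} p p-prime Ω e m N Q s 1≤e N≡ 1≤m Q≡ N≤Q s≡ 𝔽Q = go 2≤N 2≤s N≡ s≡
  where
  2≤N = ≡.subst (2 ≤_) (≡.sym N≡) (2≤p^ p-prime 1≤e)
  2≤s = ≡.subst (2 ≤_) (≡.sym s≡) (2≤p^ p-prime (ℕ.n≢0⇒n>0 (gcd[m,n]≢0 e m (inj₁ (ℕ.m<n⇒n≢0 1≤e)))))
  e≤m : e ≤ m
  e≤m = ^-cancelʳ-≤ p (ℕ.nonTrivial⇒n>1 p {{prime⇒nonTrivial p-prime}}) (≡.subst₂ _≤_ N≡ Q≡ N≤Q)
  go : ∀ {N s} .{{_ : NonZero N}} .{{_ : NonZero s}} → 2 ≤ N → 2 ≤ s → N ≡ p ^ e → s ≡ p ^ gcd e m →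
    ((+ Q - ceiling ((+ Q - 1ℤ) ℚ./ N)) - + #image Ω (Λ Ω N) 𝔽Q
    ≡ + (Q / s) - ceiling ((+ Q - 1ℤ) ℚ./ N))
    × ((𝔽N : Subfield Ω N ℓ₄) →
    ((+ Q - ceiling ((+ Q - 1ℤ) ℚ./ N)) - + #image Ω (Λ Ω N) 𝔽Q ≡ 0ℤ)
    ⇔ (member 𝔽N ⊆ member 𝔽Q))
  -- Matching on the two bounds puts `N` and `s` in the form `suc (suc _)`, which makes `N ∸ 1`
  -- compute and gives `s - 1 ≥ 1` for the cancellation.
  go (s≤s (s≤s z≤n)) (s≤s (s≤s z≤n)) N≡ s≡ = excess , excess≡0⇔⊆
    where open Excess p-prime N≡ s≡ e≤m Q≡ 𝔽Q
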